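{- Let $f(z)=\sum_{n\ge1} f_n z^n$ be a formal power series over $\mathbb{C}$ with $f_1\neq 0$ such that $-f(z)$ has compositional order exactly $2$, i.e. $-f(-f(z))=z$ and $-f(z)\neq z$. Then the set $\{g(z)\in F_0[[z]] : (g(z),f(z)) \text{ is a pseudo-involution}\}$ is an infinite subgroup of the multiplicative group $F_0[[z]]$.
   Context: $F_0[[z]]$ denotes the set of formal power series over $\mathbb{C}$ with nonzero constant term, which is a group under multiplication of power series. A Riordan matrix is a pair $(g(z),f(z))$ of formal power series over $\mathbb{C}$ with $g(z)=\sum_{n\ge 0} g_n z^n$, $g_0\neq 0$, and $f(z)=\sum_{n\ge 1} f_n z^n$ with $f_1\neq 0$; it represents the infinite lower-triangular matrix whose $k$-th column ($k\ge 0$) has generating function $g(z)f(z)^k$. Riordan matrices form a group under matrix multiplication, where $(g(z),f(z))*(h(z),l(z))=(g(z)h(f(z)),\,l(f(z)))$ and the identity is $(1,z)$. Let $M=(1,-z)$. A Riordan matrix $L$ is called a pseudo-involution if $(L*M)*(L*M)=(1,z)$. -}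

module Defs where

open import Level using (Level; 0ℓ; _⊔_)
open import Algebra.Bundles using (CommutativeRing; Group)
open import Algebra.Apartness.Bundles using (HeytingCommutativeRing; HeytingField)
import Algebra.Structures as Structures
import Algebra.Apartness.Structures as ApartnessStructures
import Algebra.Apartness.Properties.HeytingCommutativeRing as HeytingProperties
import Algebra.Properties.Monoid.Sum as MonoidSum
import Algebra.Properties.Ring as RingProperties
import Algebra.Properties.CommutativeSemigroup as CommutativeSemigroupProperties
import Algebra.Properties.Semiring.Exp as SemiringExp
open import Data.Fin.Base using (toℕ)
open import Data.Nat.Base as ℕ using (ℕ; zero; suc; _∸_)
import Data.Nat.Properties as ℕ
open import Data.Product.Base using (Σ; ∃; _×_; _,_; proj₁; proj₂)
open import Data.Sum.Base as Sum using (_⊎_; inj₁; inj₂)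
open import Function.Bundles using (Injection)
open import Relation.Binary.Bundles using (Setoid)
open import Relation.Binary.Structures using (IsEquivalence; IsApartnessRelation)
open import Relation.Binary.Definitions using (_Respects_)
open import Relation.Binary.PropositionalEquality as ≡ using (_≡_; _≢_)
import Relation.Binary.Construct.On as On
import Relation.Binary.Reasoning.Setoid as SetoidReasoning
open import Relation.Nullary using (¬_; yes; no; contradiction)
open import Relation.Unary using (Pred; _∈_)

module Rationals where

  open import Data.Rational
  open import Data.Rational.Properties
  open import Data.Rational.Solver using (module +-*-Solver)
  open +-*-Solver

  0<½ : 0ℚ < ½
  0<½ = positive⁻¹ ½

  0<1 : 0ℚ < 1ℚ
  0<1 = positive⁻¹ 1ℚ

  *-pos : ∀ {p q} → 0ℚ < p → 0ℚ < q → 0ℚ < p * q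
  *-pos {p} {q} 0<p 0<q = positive⁻¹ (p * q)
    {{pos*pos⇒pos p {{positive 0<p}} q {{positive 0<q}}}}

  half+half : ∀ p → ½ * p + ½ * p ≡ p
  half+half = solve 1 (λ p → con ½ :* p :+ con ½ :* p := p) ≡.refl

  *-mono-≤ : ∀ {p q r s} → 0ℚ ≤ r → 0ℚ ≤ q → p ≤ q → r ≤ s → p * r ≤ q * s
  *-mono-≤ {p} {q} {r} {s} 0≤r 0≤q p≤q r≤s = ≤-trans
    (*-monoʳ-≤-nonNeg r {{nonNegative 0≤r}} p≤q)
    (*-monoˡ-≤-nonNeg q {{nonNegative 0≤q}} r≤s)

  recip : ℚ → ℚ
  recip p with p ≟ 0ℚ
  ... | yes _  = 0ℚ
  ... | no p≢0 = (1/ p) {{≢-nonZero p≢0}}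

  *-recip : ∀ {p} → p ≢ 0ℚ → p * recip p ≡ 1ℚ
  *-recip {p} p≢0 with p ≟ 0ℚ
  ... | yes p≡0 = contradiction p≡0 p≢0
  ... | no q    = *-inverseʳ p {{≢-nonZero q}}

  recip-pos : ∀ {p} → 0ℚ < p → 0ℚ < recip p
  recip-pos {p} 0<p with p ≟ 0ℚ
  ... | yes p≡0 = contradiction (≡.sym p≡0) (<⇒≢ 0<p)
  ... | no q    = positive⁻¹ ((1/ p) {{≢-nonZero q}}) {{1/pos⇒pos p {{positive 0<p}}}}

  pos≢0 : ∀ {p} → 0ℚ < p → p ≢ 0ℚ
  pos≢0 0<p p≡0 = <⇒≢ 0<p (≡.sym p≡0)

  away≢0 : ∀ {δ p} → 0ℚ < δ → δ ≤ ∣ p ∣ → p ≢ 0ℚ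
  away≢0 0<δ δ≤∣p∣ ≡.refl = <-irrefl ≡.refl (<-≤-trans 0<δ δ≤∣p∣)

  ∣recip∣≤ : ∀ {δ p} → 0ℚ < δ → δ ≤ ∣ p ∣ → ∣ recip p ∣ ≤ recip δ
  ∣recip∣≤ {δ} {p} 0<δ δ≤∣p∣ = begin
    ∣ recip p ∣                        ≡⟨ *-identityʳ ∣ recip p ∣ ⟨
    ∣ recip p ∣ * 1ℚ                   ≡⟨ ≡.cong (∣ recip p ∣ *_) (*-recip (pos≢0 0<δ)) ⟨
    ∣ recip p ∣ * (δ * recip δ)        ≡⟨ *-assoc ∣ recip p ∣ δ (recip δ) ⟨
    (∣ recip p ∣ * δ) * recip δ
      ≤⟨ *-monoʳ-≤-nonNeg (recip δ) {{nonNegative (<⇒≤ (recip-pos 0<δ))}}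
           (*-monoˡ-≤-nonNeg ∣ recip p ∣ {{∣-∣-nonNeg (recip p)}} δ≤∣p∣) ⟩
    (∣ recip p ∣ * ∣ p ∣) * recip δ    ≡⟨ ≡.cong (_* recip δ) (∣p*q∣≡∣p∣*∣q∣ (recip p) p) ⟨
    ∣ recip p * p ∣ * recip δ          ≡⟨ ≡.cong (λ r → ∣ r ∣ * recip δ) (≡.trans (*-comm (recip p) p) (*-recip (away≢0 0<δ δ≤∣p∣))) ⟩
    1ℚ * recip δ                       ≡⟨ *-identityˡ (recip δ) ⟩
    recip δ                            ∎
    where open ≤-Reasoning

  ∣-∣-swap : ∀ p q → ∣ p - q ∣ ≡ ∣ q - p ∣
  ∣-∣-swap p q = ≡.trans (≡.cong ∣_∣ (solve 2 (λ p q → p :- q := :- (q :- p)) ≡.refl p q)) (∣-p∣≡∣p∣ (q - p))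

  triangle : ∀ p q → ∣ p ∣ ≤ ∣ p - q ∣ + ∣ q ∣
  triangle p q = ≤-trans
    (≤-reflexive (≡.cong ∣_∣ (solve 2 (λ p q → p := (p :- q) :+ q) ≡.refl p q)))
    (∣p+q∣≤∣p∣+∣q∣ (p - q) q)

-- Limits along a family of tails: instantiated at ℕ for convergence and at
-- ℕ × ℕ for the Cauchy condition.
module Tails
  {I : Set} (InTail : ℕ → I → Set)
  (shrink : ∀ {M N i} → M ℕ.≤ N → InTail N i → InTail M i)
  where

  open import Data.Rational
  open import Data.Rational.Properties
  open Rationals

  Eventually : (I → Set) → Set
  Eventually P = ∃ λ N → ∀ i → InTail N i → P i

  Vanishes : (I → ℚ) → Set
  Vanishes s = ∀ ε → 0ℚ < ε → Eventually λ i → ∣ s i ∣ < ε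

  Bounded : (I → ℚ) → Set
  Bounded s = ∃ λ B → 0ℚ < B × Eventually λ i → ∣ s i ∣ ≤ B

  eventually-map : ∀ {P Q : I → Set} → (∀ i → P i → Q i) → Eventually P → Eventually Q
  eventually-map f (N , p) = N , λ i t → f i (p i t)

  eventually-map₂ : ∀ {P Q R : I → Set} → (∀ i → P i → Q i → R i) →
                    Eventually P → Eventually Q → Eventually R
  eventually-map₂ f (M , p) (N , q) = M ℕ.⊔ N , λ i t →
    f i (p i (shrink (ℕ.m≤m⊔n M N) t)) (q i (shrink (ℕ.m≤n⊔m M N) t))

  vanishes-cong : ∀ {s t : I → ℚ} → Eventually (λ i → s i ≡ t i) → Vanishes s → Vanishes t
  vanishes-cong s≡t s→0 ε 0<ε =
    eventually-map₂ (λ i e → ≡.subst (λ p → ∣ p ∣ < ε) e) s≡t (s→0 ε 0<ε)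

  vanishes-≗ : ∀ {s t : I → ℚ} → (∀ i → s i ≡ t i) → Vanishes s → Vanishes t
  vanishes-≗ s≡t = vanishes-cong (0 , λ i _ → s≡t i)

  vanishes-0 : Vanishes (λ _ → 0ℚ)
  vanishes-0 ε 0<ε = 0 , λ _ _ → 0<ε

  vanishes-+ : ∀ {s t : I → ℚ} → Vanishes s → Vanishes t → Vanishes (λ i → s i + t i)
  vanishes-+ {s} {t} s→0 t→0 ε 0<ε =
    eventually-map₂
      (λ i p q → <-respʳ-≡ (half+half ε) (≤-<-trans (∣p+q∣≤∣p∣+∣q∣ (s i) (t i)) (+-mono-< p q)))
      (s→0 (½ * ε) (*-pos 0<½ 0<ε)) (t→0 (½ * ε) (*-pos 0<½ 0<ε))

  vanishes-neg : ∀ {s : I → ℚ} → Vanishes s → Vanishes (λ i → - s i)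
  vanishes-neg {s} s→0 ε 0<ε =
    eventually-map (λ i → <-respˡ-≡ (≡.sym (∣-p∣≡∣p∣ (s i)))) (s→0 ε 0<ε)

  vanishes-* : ∀ {b s : I → ℚ} → Bounded b → Vanishes s → Vanishes (λ i → b i * s i)
  vanishes-* {b} {s} (B , 0<B , b≤B) s→0 ε 0<ε =
    eventually-map₂ step b≤B (s→0 (recip B * ε) (*-pos (recip-pos 0<B) 0<ε))
    where
    step : ∀ i → ∣ b i ∣ ≤ B → ∣ s i ∣ < recip B * ε → ∣ b i * s i ∣ < ε
    step i p q = begin-strict
      ∣ b i * s i ∣       ≡⟨ ∣p*q∣≡∣p∣*∣q∣ (b i) (s i) ⟩
      ∣ b i ∣ * ∣ s i ∣   ≤⟨ *-monoʳ-≤-nonNeg ∣ s i ∣ {{∣-∣-nonNeg (s i)}} p ⟩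
      B * ∣ s i ∣         <⟨ *-monoʳ-<-pos B {{positive 0<B}} q ⟩
      B * (recip B * ε)   ≡⟨ *-assoc B (recip B) ε ⟨
      B * recip B * ε     ≡⟨ ≡.cong (_* ε) (*-recip (pos≢0 0<B)) ⟩
      1ℚ * ε              ≡⟨ *-identityˡ ε ⟩
      ε                   ∎
      where open ≤-Reasoning

  bounded-* : ∀ {a b : I → ℚ} → Bounded a → Bounded b → Bounded (λ i → a i * b i)
  bounded-* {a} {b} (A , 0<A , a≤A) (B , 0<B , b≤B) =
    A * B , *-pos 0<A 0<B ,
    eventually-map₂
      (λ i p q → ≤-trans (≤-reflexive (∣p*q∣≡∣p∣*∣q∣ (a i) (b i)))
                         (*-mono-≤ (0≤∣p∣ (b i)) (<⇒≤ 0<A) p q))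
      a≤A b≤B

module Reals where

  open import Data.Rational
  open import Data.Rational.Properties
  open import Data.Rational.Solver using (module +-*-Solver)
  open +-*-Solver
  open Rationals

  InTail₂ : ℕ → ℕ × ℕ → Set
  InTail₂ N (m , n) = N ℕ.≤ m × N ℕ.≤ n

  InTail₂-shrink : ∀ {M N i} → M ℕ.≤ N → InTail₂ N i → InTail₂ M i
  InTail₂-shrink M≤N (p , q) = ℕ.≤-trans M≤N p , ℕ.≤-trans M≤N q

  module Seq  = Tails ℕ._≤_ ℕ.≤-trans
  module Seq₂ = Tails InTail₂ InTail₂-shrink

  Cauchy : (ℕ → ℚ) → Set
  Cauchy s = Seq₂.Vanishes λ (m , n) → s m - s n

  record ℝ : Set where
    constructor mkℝ
    field
      seq    : ℕ → ℚ
      cauchy : Cauchy seq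
  open ℝ public

  infix 4 _≈ʳ_
  record _≈ʳ_ (x y : ℝ) : Set where
    constructor mk≈
    field
      vanishes : Seq.Vanishes λ n → seq x n - seq y n
  open _≈ʳ_ public

  -- Bounded away from 0; by ¬nonZero⇒≈0 below, its negation is x ≈ʳ 0ʳ.
  record NonZeroʳ (x : ℝ) : Set where
    constructor mkNonZero
    field
      δ    : ℚ
      0<δ  : 0ℚ < δ
      away : Seq.Eventually λ n → δ ≤ ∣ seq x n ∣

  abstract
    cauchy-bounded : ∀ (x : ℝ) → Seq.Bounded (seq x)
    cauchy-bounded (mkℝ s c) with c 1ℚ 0<1
    ... | N , p = 1ℚ + ∣ s N ∣ ,
      <-≤-trans 0<1 (≤-trans (≤-reflexive (≡.sym (+-identityʳ 1ℚ))) (+-monoʳ-≤ 1ℚ (0≤∣p∣ (s N)))) ,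
      N , λ n N≤n → ≤-trans (triangle (s n) (s N)) (+-monoˡ-≤ ∣ s N ∣ (<⇒≤ (p (n , N) (N≤n , ℕ.≤-refl))))

  bounded-fst : ∀ {s} → Seq.Bounded s → Seq₂.Bounded (λ (m , n) → s m)
  bounded-fst (B , 0<B , N , p) = B , 0<B , N , λ (m , n) t → p m (proj₁ t)

  bounded-snd : ∀ {s} → Seq.Bounded s → Seq₂.Bounded (λ (m , n) → s n)
  bounded-snd (B , 0<B , N , p) = B , 0<B , N , λ (m , n) t → p n (proj₂ t)

  abstract
    const-cauchy : ∀ p → Cauchy (λ _ → p)
    const-cauchy p = Seq₂.vanishes-≗ (λ _ → ≡.sym (+-inverseʳ p)) Seq₂.vanishes-0

    +-cauchy : ∀ x y → Cauchy (λ n → seq x n + seq y n)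
    +-cauchy (mkℝ s c) (mkℝ t d) = Seq₂.vanishes-≗
      (λ (m , n) → solve 4 (λ a b c d → (a :- b) :+ (c :- d) := (a :+ c) :- (b :+ d)) ≡.refl (s m) (s n) (t m) (t n))
      (Seq₂.vanishes-+ c d)

    neg-cauchy : ∀ x → Cauchy (λ n → - seq x n)
    neg-cauchy (mkℝ s c) = Seq₂.vanishes-≗
      (λ (m , n) → solve 2 (λ a b → :- (a :- b) := (:- a) :- (:- b)) ≡.refl (s m) (s n))
      (Seq₂.vanishes-neg c)

    *-cauchy : ∀ x y → Cauchy (λ n → seq x n * seq y n)
    *-cauchy x@(mkℝ s c) y@(mkℝ t d) = Seq₂.vanishes-≗
      (λ (m , n) → solve 4 (λ a b c d → c :* (a :- b) :+ b :* (c :- d) := a :* c :- b :* d) ≡.refl (s m) (s n) (t m) (t n))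
      (Seq₂.vanishes-+ (Seq₂.vanishes-* (bounded-fst (cauchy-bounded y)) c)
                       (Seq₂.vanishes-* (bounded-snd (cauchy-bounded x)) d))

    recip-cauchy : ∀ x → NonZeroʳ x → Cauchy (λ n → recip (seq x n))
    recip-cauchy (mkℝ s c) (mkNonZero δ 0<δ (N , p)) = Seq₂.vanishes-cong
      (N , λ (m , n) (N≤m , N≤n) → eq (away≢0 0<δ (p m N≤m)) (away≢0 0<δ (p n N≤n)))
      (Seq₂.vanishes-* (Seq₂.bounded-* (bounded-fst b) (bounded-snd b)) (Seq₂.vanishes-neg c))
      where
      b : Seq.Bounded (λ n → recip (s n))
      b = recip δ , recip-pos 0<δ , N , λ n N≤n → ∣recip∣≤ 0<δ (p n N≤n)
      eq : ∀ {u v} → u ≢ 0ℚ → v ≢ 0ℚ → recip u * recip v * - (u - v) ≡ recip u - recip v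
      eq {u} {v} u≢0 v≢0 = begin
        recip u * recip v * - (u - v)
          ≡⟨ solve 4 (λ u v a b → a :* b :* (:- (u :- v)) := a :* (v :* b) :- b :* (u :* a)) ≡.refl u v (recip u) (recip v) ⟩
        recip u * (v * recip v) - recip v * (u * recip u)
          ≡⟨ ≡.cong₂ (λ a b → recip u * a - recip v * b) (*-recip v≢0) (*-recip u≢0) ⟩
        recip u * 1ℚ - recip v * 1ℚ
          ≡⟨ ≡.cong₂ _-_ (*-identityʳ (recip u)) (*-identityʳ (recip v)) ⟩
        recip u - recip v ∎
        where open ≡.≡-Reasoning

  infixl 6 _+ʳ_ _-ʳ_
  infixl 7 _*ʳ_
  infix  8 -ʳ_

  fromℚ : ℚ → ℝ
  fromℚ p = mkℝ (λ _ → p) (const-cauchy p)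

  0ʳ 1ʳ : ℝ
  0ʳ = fromℚ 0ℚ
  1ʳ = fromℚ 1ℚ

  _+ʳ_ : ℝ → ℝ → ℝ
  x +ʳ y = mkℝ (λ n → seq x n + seq y n) (+-cauchy x y)

  -ʳ_ : ℝ → ℝ
  -ʳ x = mkℝ (λ n → - seq x n) (neg-cauchy x)

  _*ʳ_ : ℝ → ℝ → ℝ
  x *ʳ y = mkℝ (λ n → seq x n * seq y n) (*-cauchy x y)

  _-ʳ_ : ℝ → ℝ → ℝ
  x -ʳ y = x +ʳ (-ʳ y)

  eventually≡⇒≈ : ∀ {x y} → Seq.Eventually (λ n → seq x n ≡ seq y n) → x ≈ʳ y
  eventually≡⇒≈ {x} {y} e = mk≈ (Seq.vanishes-cong
    (Seq.eventually-map (λ n p → ≡.sym (≡.trans (≡.cong (_- seq y n) p) (+-inverseʳ (seq y n)))) e)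
    Seq.vanishes-0)

  ≗⇒≈ : ∀ {x y} → (∀ n → seq x n ≡ seq y n) → x ≈ʳ y
  ≗⇒≈ e = eventually≡⇒≈ (0 , λ n _ → e n)

  ≈ʳ-refl : ∀ {x} → x ≈ʳ x
  ≈ʳ-refl = ≗⇒≈ λ _ → ≡.refl

  ≈ʳ-sym : ∀ {x y} → x ≈ʳ y → y ≈ʳ x
  ≈ʳ-sym {x} {y} (mk≈ v) = mk≈ (Seq.vanishes-≗
    (λ n → solve 2 (λ a b → :- (a :- b) := b :- a) ≡.refl (seq x n) (seq y n))
    (Seq.vanishes-neg v))

  ≈ʳ-trans : ∀ {x y z} → x ≈ʳ y → y ≈ʳ z → x ≈ʳ z
  ≈ʳ-trans {x} {y} {z} (mk≈ v) (mk≈ w) = mk≈ (Seq.vanishes-≗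
    (λ n → solve 3 (λ a b c → (a :- b) :+ (b :- c) := a :- c) ≡.refl (seq x n) (seq y n) (seq z n))
    (Seq.vanishes-+ v w))

  +ʳ-cong : ∀ {x x′ y y′} → x ≈ʳ x′ → y ≈ʳ y′ → x +ʳ y ≈ʳ x′ +ʳ y′
  +ʳ-cong {x} {x′} {y} {y′} (mk≈ v) (mk≈ w) = mk≈ (Seq.vanishes-≗
    (λ n → solve 4 (λ a b c d → (a :- b) :+ (c :- d) := (a :+ c) :- (b :+ d)) ≡.refl (seq x n) (seq x′ n) (seq y n) (seq y′ n))
    (Seq.vanishes-+ v w))

  -ʳ-cong : ∀ {x y} → x ≈ʳ y → -ʳ x ≈ʳ -ʳ y
  -ʳ-cong {x} {y} (mk≈ v) = mk≈ (Seq.vanishes-≗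
    (λ n → solve 2 (λ a b → :- (a :- b) := (:- a) :- (:- b)) ≡.refl (seq x n) (seq y n))
    (Seq.vanishes-neg v))

  *ʳ-cong : ∀ {x x′ y y′} → x ≈ʳ x′ → y ≈ʳ y′ → x *ʳ y ≈ʳ x′ *ʳ y′
  *ʳ-cong {x} {x′} {y} {y′} (mk≈ v) (mk≈ w) = mk≈ (Seq.vanishes-≗
    (λ n → solve 4 (λ a b c d → c :* (a :- b) :+ b :* (c :- d) := a :* c :- b :* d) ≡.refl (seq x n) (seq x′ n) (seq y n) (seq y′ n))
    (Seq.vanishes-+ (Seq.vanishes-* (cauchy-bounded y) v) (Seq.vanishes-* (cauchy-bounded x′) w)))

  nonZero-1 : NonZeroʳ 1ʳ
  nonZero-1 = mkNonZero 1ℚ 0<1 (0 , λ _ _ → ≤-refl)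

  nonZero-cong : ∀ {x y} → x ≈ʳ y → NonZeroʳ x → NonZeroʳ y
  nonZero-cong {x} {y} (mk≈ v) (mkNonZero δ 0<δ away) =
    mkNonZero (½ * δ) (*-pos 0<½ 0<δ) (Seq.eventually-map₂ step (v (½ * δ) (*-pos 0<½ 0<δ)) away)
    where
    step : ∀ n → ∣ seq x n - seq y n ∣ < ½ * δ → δ ≤ ∣ seq x n ∣ → ½ * δ ≤ ∣ seq y n ∣
    step n p q = ≮⇒≥ λ r → <-irrefl ≡.refl
      (<-≤-trans (≤-<-trans (triangle (seq x n) (seq y n)) (<-respʳ-≡ (half+half δ) (+-mono-< p r))) q)

  nonZero⇒≉0 : ∀ {x} → x ≈ʳ 0ʳ → ¬ NonZeroʳ x
  nonZero⇒≉0 x≈0 x≠0 = ¬nonZero-0 (nonZero-cong x≈0 x≠0)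
    where
    ¬nonZero-0 : ¬ NonZeroʳ 0ʳ
    ¬nonZero-0 (mkNonZero δ 0<δ (N , p)) = away≢0 0<δ (p N ℕ.≤-refl) ≡.refl

  locate : ∀ x ε → 0ℚ < ε → NonZeroʳ x ⊎ Seq.Eventually (λ n → ∣ seq x n ∣ < ε)
  locate (mkℝ s c) ε 0<ε with c (½ * (½ * ε)) (*-pos 0<½ (*-pos 0<½ 0<ε))
  ... | N , p with ∣ s N ∣ <? ½ * ε
  ...   | yes sN<h = inj₂ (N , λ n N≤n → <-respʳ-≡ (half+half ε)
            (≤-<-trans (triangle (s n) (s N)) (+-mono-< (<-trans (p (n , N) (N≤n , ℕ.≤-refl)) q<h) sN<h)))
    where
    0<q : 0ℚ < ½ * (½ * ε)
    0<q = *-pos 0<½ (*-pos 0<½ 0<ε)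
    q<h : ½ * (½ * ε) < ½ * ε
    q<h = <-respʳ-≡ (half+half (½ * ε)) (<-respˡ-≡ (+-identityʳ (½ * (½ * ε))) (+-monoʳ-< (½ * (½ * ε)) 0<q))
  ...   | no sN≮h = inj₁ (mkNonZero (½ * (½ * ε)) (*-pos 0<½ (*-pos 0<½ 0<ε)) (N , λ n N≤n → ≮⇒≥ λ r →
            sN≮h (<-respʳ-≡ (half+half (½ * ε))
              (≤-<-trans (triangle (s N) (s n)) (+-mono-< (p (N , n) (ℕ.≤-refl , N≤n)) r)))))

  ¬nonZero⇒≈0 : ∀ {x} → ¬ NonZeroʳ x → x ≈ʳ 0ʳ
  ¬nonZero⇒≈0 {x} ¬nz = mk≈ (Seq.vanishes-≗ (λ n → ≡.sym (+-identityʳ (seq x n))) v)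
    where
    v : Seq.Vanishes (seq x)
    v ε 0<ε = Sum.[ (λ nz → contradiction nz ¬nz) , (λ e → e) ] (locate x ε 0<ε)

  nonZero-+ : ∀ x y → NonZeroʳ (x +ʳ y) → NonZeroʳ x ⊎ NonZeroʳ y
  nonZero-+ x y (mkNonZero δ 0<δ away) =
    split (locate x (½ * δ) (*-pos 0<½ 0<δ)) (locate y (½ * δ) (*-pos 0<½ 0<δ))
    where
    split : NonZeroʳ x ⊎ Seq.Eventually (λ n → ∣ seq x n ∣ < ½ * δ) →
            NonZeroʳ y ⊎ Seq.Eventually (λ n → ∣ seq y n ∣ < ½ * δ) →
            NonZeroʳ x ⊎ NonZeroʳ y
    split (inj₁ p) _        = inj₁ p
    split (inj₂ _) (inj₁ q) = inj₂ q
    split (inj₂ p) (inj₂ q) = contradiction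
      (<-≤-trans (proj₂ small (proj₁ small ℕ.⊔ proj₁ away) (ℕ.m≤m⊔n (proj₁ small) (proj₁ away)))
                 (proj₂ away (proj₁ small ℕ.⊔ proj₁ away) (ℕ.m≤n⊔m (proj₁ small) (proj₁ away))))
      (<-irrefl ≡.refl)
      where
      small : Seq.Eventually (λ n → ∣ seq x n + seq y n ∣ < δ)
      small = Seq.eventually-map₂
        (λ n a b → ≤-<-trans (∣p+q∣≤∣p∣+∣q∣ (seq x n) (seq y n)) (<-respʳ-≡ (half+half δ) (+-mono-< a b))) p q
  nonZero-*ˡ : ∀ x y → NonZeroʳ (x *ʳ y) → NonZeroʳ x
  nonZero-*ˡ x y (mkNonZero δ 0<δ away) =
    mkNonZero (δ * recip B) (*-pos 0<δ (recip-pos 0<B)) (Seq.eventually-map₂ step (proj₂ (proj₂ bound)) away)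
    where
    bound : Seq.Bounded (seq y)
    bound = cauchy-bounded y
    B : ℚ
    B = proj₁ bound
    0<B : 0ℚ < B
    0<B = proj₁ (proj₂ bound)
    step : ∀ n → ∣ seq y n ∣ ≤ B → δ ≤ ∣ seq x n * seq y n ∣ → δ * recip B ≤ ∣ seq x n ∣
    step n p q = begin
      δ * recip B                            ≤⟨ *-monoʳ-≤-nonNeg (recip B) {{nonNegative (<⇒≤ (recip-pos 0<B))}} q ⟩
      ∣ seq x n * seq y n ∣ * recip B        ≡⟨ ≡.cong (_* recip B) (∣p*q∣≡∣p∣*∣q∣ (seq x n) (seq y n)) ⟩
      ∣ seq x n ∣ * ∣ seq y n ∣ * recip B
        ≤⟨ *-monoʳ-≤-nonNeg (recip B) {{nonNegative (<⇒≤ (recip-pos 0<B))}}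
             (*-monoˡ-≤-nonNeg ∣ seq x n ∣ {{∣-∣-nonNeg (seq x n)}} p) ⟩
      ∣ seq x n ∣ * B * recip B              ≡⟨ *-assoc ∣ seq x n ∣ B (recip B) ⟩
      ∣ seq x n ∣ * (B * recip B)            ≡⟨ ≡.cong (∣ seq x n ∣ *_) (*-recip (pos≢0 0<B)) ⟩
      ∣ seq x n ∣ * 1ℚ                       ≡⟨ *-identityʳ ∣ seq x n ∣ ⟩
      ∣ seq x n ∣                            ∎
      where open ≤-Reasoning

  nonZero-neg : ∀ x → NonZeroʳ x → NonZeroʳ (-ʳ x)
  nonZero-neg x (mkNonZero δ 0<δ away) =
    mkNonZero δ 0<δ (Seq.eventually-map (λ n p → ≤-trans p (≤-reflexive (≡.sym (∣-p∣≡∣p∣ (seq x n))))) away)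

  sum-of-squares : ∀ x y → NonZeroʳ x → NonZeroʳ (x *ʳ x +ʳ y *ʳ y)
  sum-of-squares x y (mkNonZero δ 0<δ away) = mkNonZero (δ * δ) (*-pos 0<δ 0<δ) (Seq.eventually-map step away)
    where
    square : ∀ p → ∣ p ∣ * ∣ p ∣ ≡ p * p
    square p with ∣p∣≡p∨∣p∣≡-p p
    ... | inj₁ e = ≡.cong₂ _*_ e e
    ... | inj₂ e = ≡.trans (≡.cong₂ _*_ e e) (solve 1 (λ p → (:- p) :* (:- p) := p :* p) ≡.refl p)
    0≤square : ∀ p → 0ℚ ≤ p * p
    0≤square p = ≤-trans
      (nonNegative⁻¹ (∣ p ∣ * ∣ p ∣) {{nonNeg*nonNeg⇒nonNeg (∣ p ∣) {{∣-∣-nonNeg p}} (∣ p ∣) {{∣-∣-nonNeg p}}}})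
      (≤-reflexive (square p))
    step : ∀ n → δ ≤ ∣ seq x n ∣ → δ * δ ≤ ∣ seq x n * seq x n + seq y n * seq y n ∣
    step n p = begin
      δ * δ                                      ≤⟨ *-mono-≤ (<⇒≤ 0<δ) (0≤∣p∣ (seq x n)) p p ⟩
      ∣ seq x n ∣ * ∣ seq x n ∣                  ≡⟨ square (seq x n) ⟩
      seq x n * seq x n                          ≡⟨ +-identityʳ (seq x n * seq x n) ⟨
      seq x n * seq x n + 0ℚ                     ≤⟨ +-monoʳ-≤ (seq x n * seq x n) (0≤square (seq y n)) ⟩
      seq x n * seq x n + seq y n * seq y n
        ≡⟨ 0≤p⇒∣p∣≡p (+-mono-≤ (0≤square (seq x n)) (0≤square (seq y n))) ⟨
      ∣ seq x n * seq x n + seq y n * seq y n ∣  ∎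
      where open ≤-Reasoning

  recipʳ : ∀ x → NonZeroʳ x → ℝ
  recipʳ x x≠0 = mkℝ (λ n → recip (seq x n)) (recip-cauchy x x≠0)

  *ʳ-recipʳ : ∀ x (x≠0 : NonZeroʳ x) → x *ʳ recipʳ x x≠0 ≈ʳ 1ʳ
  *ʳ-recipʳ x (mkNonZero δ 0<δ (N , p)) = eventually≡⇒≈ (N , λ n N≤n → *-recip (away≢0 0<δ (p n N≤n)))


module Complex where

  open import Data.Rational.Solver using (module +-*-Solver)
  open +-*-Solver
  open Reals

  record ℂ : Set where
    constructor _+i_
    field
      re im : ℝ
  open ℂ public

  infix 4 _≈_ _#_
  record _≈_ (z w : ℂ) : Set where
    constructor mk≈ᶜ
    field
      re-≈ : re z ≈ʳ re w
      im-≈ : im z ≈ʳ im w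
  open _≈_ public

  data _#_ (z w : ℂ) : Set where
    re-# : NonZeroʳ (re z -ʳ re w) → z # w
    im-# : NonZeroʳ (im z -ʳ im w) → z # w

  infixl 6 _+_
  infixl 7 _*_
  infix  8 -_

  _+_ _*_ : ℂ → ℂ → ℂ
  (a +i b) + (c +i d) = (a +ʳ c) +i (b +ʳ d)
  (a +i b) * (c +i d) = (a *ʳ c -ʳ b *ʳ d) +i (a *ʳ d +ʳ b *ʳ c)

  -_ : ℂ → ℂ
  - (a +i b) = (-ʳ a) +i (-ʳ b)

  0ᶜ 1ᶜ : ℂ
  0ᶜ = 0ʳ +i 0ʳ
  1ᶜ = 1ʳ +i 0ʳ

  open Structures _≈_ using (IsCommutativeRing)
  open ApartnessStructures _≈_ _#_ _+_ _*_ -_ 0ᶜ 1ᶜ using (IsHeytingCommutativeRing; IsHeytingField)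

  ≈-isEquivalence : IsEquivalence _≈_
  ≈-isEquivalence = record
    { refl  = mk≈ᶜ ≈ʳ-refl ≈ʳ-refl
    ; sym   = λ (mk≈ᶜ p q) → mk≈ᶜ (≈ʳ-sym p) (≈ʳ-sym q)
    ; trans = λ (mk≈ᶜ p q) (mk≈ᶜ r s) → mk≈ᶜ (≈ʳ-trans p r) (≈ʳ-trans q s)
    }

  *-comm : ∀ z w → z * w ≈ w * z
  *-comm (a +i b) (c +i d) = mk≈ᶜ
    (≗⇒≈ λ n → solve 4 (λ a b c d → a :* c :- b :* d := c :* a :- d :* b) ≡.refl (seq a n) (seq b n) (seq c n) (seq d n))
    (≗⇒≈ λ n → solve 4 (λ a b c d → a :* d :+ b :* c := c :* b :+ d :* a) ≡.refl (seq a n) (seq b n) (seq c n) (seq d n))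

  isCommutativeRing : IsCommutativeRing _+_ _*_ -_ 0ᶜ 1ᶜ
  isCommutativeRing = record
    { isRing = record
      { +-isAbelianGroup = record
        { isGroup = record
          { isMonoid = record
            { isSemigroup = record
              { isMagma = record
                { isEquivalence = ≈-isEquivalence
                ; ∙-cong = λ (mk≈ᶜ p q) (mk≈ᶜ r s) → mk≈ᶜ (+ʳ-cong p r) (+ʳ-cong q s)
                }
              ; assoc = λ z w v → mk≈ᶜ
                  (≗⇒≈ λ n → ℚ.+-assoc (seq (re z) n) (seq (re w) n) (seq (re v) n))
                  (≗⇒≈ λ n → ℚ.+-assoc (seq (im z) n) (seq (im w) n) (seq (im v) n))
              }
            ; identity =
                (λ z → mk≈ᶜ (≗⇒≈ λ n → ℚ.+-identityˡ (seq (re z) n)) (≗⇒≈ λ n → ℚ.+-identityˡ (seq (im z) n))) ,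
                (λ z → mk≈ᶜ (≗⇒≈ λ n → ℚ.+-identityʳ (seq (re z) n)) (≗⇒≈ λ n → ℚ.+-identityʳ (seq (im z) n)))
            }
          ; inverse =
              (λ z → mk≈ᶜ (≗⇒≈ λ n → ℚ.+-inverseˡ (seq (re z) n)) (≗⇒≈ λ n → ℚ.+-inverseˡ (seq (im z) n))) ,
              (λ z → mk≈ᶜ (≗⇒≈ λ n → ℚ.+-inverseʳ (seq (re z) n)) (≗⇒≈ λ n → ℚ.+-inverseʳ (seq (im z) n)))
          ; ⁻¹-cong = λ (mk≈ᶜ p q) → mk≈ᶜ (-ʳ-cong p) (-ʳ-cong q)
          }
        ; comm = λ z w → mk≈ᶜ
            (≗⇒≈ λ n → ℚ.+-comm (seq (re z) n) (seq (re w) n))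
            (≗⇒≈ λ n → ℚ.+-comm (seq (im z) n) (seq (im w) n))
        }
      ; *-cong = λ (mk≈ᶜ p q) (mk≈ᶜ r s) → mk≈ᶜ
          (+ʳ-cong (*ʳ-cong p r) (-ʳ-cong (*ʳ-cong q s)))
          (+ʳ-cong (*ʳ-cong p s) (*ʳ-cong q r))
      ; *-assoc = λ (a +i b) (c +i d) (e +i f) → mk≈ᶜ
          (≗⇒≈ λ n → solve 6 (λ a b c d e f →
            (a :* c :- b :* d) :* e :- (a :* d :+ b :* c) :* f := a :* (c :* e :- d :* f) :- b :* (c :* f :+ d :* e))
            ≡.refl (seq a n) (seq b n) (seq c n) (seq d n) (seq e n) (seq f n))
          (≗⇒≈ λ n → solve 6 (λ a b c d e f →
            (a :* c :- b :* d) :* f :+ (a :* d :+ b :* c) :* e := a :* (c :* f :+ d :* e) :+ b :* (c :* e :- d :* f))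
            ≡.refl (seq a n) (seq b n) (seq c n) (seq d n) (seq e n) (seq f n))
      ; *-identity = 1*z≈z , λ z → IsEquivalence.trans ≈-isEquivalence (*-comm z 1ᶜ) (1*z≈z z)
      ; distrib = distribˡ , λ z w v → IsEquivalence.trans ≈-isEquivalence (*-comm (w + v) z)
          (IsEquivalence.trans ≈-isEquivalence (distribˡ z w v)
            (mk≈ᶜ (+ʳ-cong (re-≈ (*-comm z w)) (re-≈ (*-comm z v)))
                  (+ʳ-cong (im-≈ (*-comm z w)) (im-≈ (*-comm z v)))))
      }
    ; *-comm = *-comm
    }
    where
    import Data.Rational.Properties as ℚ
    open import Data.Rational using (0ℚ; 1ℚ)
    1*z≈z : ∀ z → 1ᶜ * z ≈ z
    1*z≈z (a +i b) = mk≈ᶜ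
      (≗⇒≈ λ n → solve 2 (λ a b → con 1ℚ :* a :- con 0ℚ :* b := a) ≡.refl (seq a n) (seq b n))
      (≗⇒≈ λ n → solve 2 (λ a b → con 1ℚ :* b :+ con 0ℚ :* a := b) ≡.refl (seq a n) (seq b n))
    distribˡ : ∀ z w v → z * (w + v) ≈ z * w + z * v
    distribˡ (a +i b) (c +i d) (e +i f) = mk≈ᶜ
      (≗⇒≈ λ n → solve 6 (λ a b c d e f →
        a :* (c :+ e) :- b :* (d :+ f) := (a :* c :- b :* d) :+ (a :* e :- b :* f))
        ≡.refl (seq a n) (seq b n) (seq c n) (seq d n) (seq e n) (seq f n))
      (≗⇒≈ λ n → solve 6 (λ a b c d e f →
        a :* (d :+ f) :+ b :* (c :+ e) := (a :* d :+ b :* c) :+ (a :* f :+ b :* e))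
        ≡.refl (seq a n) (seq b n) (seq c n) (seq d n) (seq e n) (seq f n))

  private
    ring : CommutativeRing 0ℓ 0ℓ
    ring = record { isCommutativeRing = isCommutativeRing }
    open CommutativeRing ring using (_-_; trans)

    swap : ∀ x y → -ʳ (x -ʳ y) ≈ʳ y -ʳ x
    swap x y = ≗⇒≈ λ n → solve 2 (λ a b → :- (a :- b) := b :- a) ≡.refl (seq x n) (seq y n)

    telescope : ∀ x y z → x -ʳ y ≈ʳ (x -ʳ z) +ʳ (z -ʳ y)
    telescope x y z = ≗⇒≈ λ n →
      solve 3 (λ a b c → a :- b := (a :- c) :+ (c :- b)) ≡.refl (seq x n) (seq y n) (seq z n)

    minus-≈ : ∀ {x y} → x ≈ʳ y → x -ʳ y ≈ʳ 0ʳ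
    minus-≈ {x} {y} x≈y = ≈ʳ-trans (+ʳ-cong x≈y ≈ʳ-refl) (≗⇒≈ λ n → +-inverseʳ (seq y n))
      where open import Data.Rational.Properties using (+-inverseʳ)

    minus-≈⁻¹ : ∀ {x y} → x -ʳ y ≈ʳ 0ʳ → x ≈ʳ y
    minus-≈⁻¹ {x} {y} d≈0 = ≈ʳ-trans
      (≗⇒≈ λ n → solve 2 (λ a b → a := (a :- b) :+ b) ≡.refl (seq x n) (seq y n))
      (≈ʳ-trans (+ʳ-cong d≈0 (≈ʳ-refl {y})) (≗⇒≈ λ n → +-identityˡ (seq y n)))
      where open import Data.Rational.Properties using (+-identityˡ)

  #-isApartnessRelation : IsApartnessRelation _≈_ _#_
  #-isApartnessRelation = record
    { irrefl  = irrefl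
    ; sym     = #-sym
    ; cotrans = cotrans
    }
    where
    irrefl : ∀ {z w} → z ≈ w → ¬ z # w
    irrefl (mk≈ᶜ p q) (re-# r) = nonZero⇒≉0 (minus-≈ p) r
    irrefl (mk≈ᶜ p q) (im-# r) = nonZero⇒≉0 (minus-≈ q) r
    #-sym : ∀ {z w} → z # w → w # z
    #-sym {z} {w} (re-# r) = re-# (nonZero-cong (swap (re z) (re w)) (nonZero-neg (re z -ʳ re w) r))
    #-sym {z} {w} (im-# r) = im-# (nonZero-cong (swap (im z) (im w)) (nonZero-neg (im z -ʳ im w) r))
    cotrans : ∀ {z w} → z # w → ∀ v → z # v ⊎ v # w
    cotrans {z} {w} (re-# r) v = Sum.map re-# re-#
      (nonZero-+ (re z -ʳ re v) (re v -ʳ re w) (nonZero-cong (telescope (re z) (re w) (re v)) r))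
    cotrans {z} {w} (im-# r) v = Sum.map im-# im-#
      (nonZero-+ (im z -ʳ im v) (im v -ʳ im w) (nonZero-cong (telescope (im z) (im w) (im v)) r))

  normSq : ℂ → ℝ
  normSq (a +i b) = a *ʳ a +ʳ b *ʳ b

  normSq-nonZero : ∀ z → NonZeroʳ (re z) ⊎ NonZeroʳ (im z) → NonZeroʳ (normSq z)
  normSq-nonZero (a +i b) (inj₁ p) = sum-of-squares a b p
  normSq-nonZero (a +i b) (inj₂ p) = nonZero-cong
    (≗⇒≈ λ n → solve 2 (λ a b → b :* b :+ a :* a := a :* a :+ b :* b) ≡.refl (seq a n) (seq b n))
    (sum-of-squares b a p)

  inverse : ∀ z → NonZeroʳ (normSq z) → ℂ
  inverse z p = (re z *ʳ recipʳ (normSq z) p) +i (-ʳ (im z *ʳ recipʳ (normSq z) p))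

  *-inverseʳ : ∀ z (p : NonZeroʳ (normSq z)) → z * inverse z p ≈ 1ᶜ
  *-inverseʳ z@(a +i b) p = mk≈ᶜ
    (≈ʳ-trans
      (≗⇒≈ λ n → solve 3 (λ a b s → a :* (a :* s) :- b :* (:- (b :* s)) := (a :* a :+ b :* b) :* s)
        ≡.refl (seq a n) (seq b n) (seq (recipʳ (normSq z) p) n))
      (*ʳ-recipʳ (normSq z) p))
    (≗⇒≈ λ n → solve 3 (λ a b s → a :* (:- (b :* s)) :+ b :* (a :* s) := con 0ℚ)
        ≡.refl (seq a n) (seq b n) (seq (recipʳ (normSq z) p) n))
    where open import Data.Rational using (0ℚ)

  isHeytingCommutativeRing : IsHeytingCommutativeRing
  isHeytingCommutativeRing = record
    { isCommutativeRing   = isCommutativeRing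
    ; isApartnessRelation = #-isApartnessRelation
    ; #⇒invertible = λ {z} {w} z#w → let p = normSq-nonZero (z - w) (parts z#w) in
        inverse (z - w) p , trans (*-comm (inverse (z - w) p) (z - w)) (*-inverseʳ (z - w) p) , *-inverseʳ (z - w) p
    ; invertible⇒# = λ {z} {w} (v , _ , e) → from-parts (nonZero-re (z - w) v (nonZero-cong (≈ʳ-sym (re-≈ e)) nonZero-1))
    }
    where
    parts : ∀ {z w} → z # w → NonZeroʳ (re (z - w)) ⊎ NonZeroʳ (im (z - w))
    parts (re-# p) = inj₁ p
    parts (im-# p) = inj₂ p
    from-parts : ∀ {z w} → NonZeroʳ (re (z - w)) ⊎ NonZeroʳ (im (z - w)) → z # w
    from-parts (inj₁ p) = re-# p
    from-parts (inj₂ p) = im-# p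
    nonZero-re : ∀ z v → NonZeroʳ (re (z * v)) → NonZeroʳ (re z) ⊎ NonZeroʳ (im z)
    nonZero-re (a +i b) (c +i d) p = Sum.map
      (nonZero-*ˡ a c)
      (λ q → nonZero-*ˡ b d
        (nonZero-cong (≗⇒≈ λ n → solve 2 (λ b d → :- (:- (b :* d)) := b :* d) ≡.refl (seq b n) (seq d n))
          (nonZero-neg (-ʳ (b *ʳ d)) q)))
      (nonZero-+ (a *ʳ c) (-ʳ (b *ʳ d)) p)

  isHeytingField : IsHeytingField
  isHeytingField = record
    { isHeytingCommutativeRing = isHeytingCommutativeRing
    ; tight = λ z w →
        (λ ¬z#w → mk≈ᶜ (minus-≈⁻¹ (¬nonZero⇒≈0 λ p → ¬z#w (re-# p))) (minus-≈⁻¹ (¬nonZero⇒≈0 λ p → ¬z#w (im-# p)))) ,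
        IsApartnessRelation.irrefl #-isApartnessRelation
    }

  ℂ-field : HeytingField 0ℓ 0ℓ 0ℓ
  ℂ-field = record { isHeytingField = isHeytingField }

module PowerSeries {c ℓ₁ ℓ₂ : Level} (K : HeytingField c ℓ₁ ℓ₂) where

  open HeytingField K using (_#_; #⇒invertible; heytingCommutativeRing)
  open HeytingProperties heytingCommutativeRing using (1#0; x#0y#0→xy#0; #-congʳ; x-0≈x; invertibleˡ⇒#)

  coefficientRing : CommutativeRing c ℓ₁
  coefficientRing = HeytingCommutativeRing.commutativeRing heytingCommutativeRing

  open CommutativeRing coefficientRing
  open RingProperties ring using (-1*x≈-x; -‿involutive; -0#≈0#)
  open CommutativeSemigroupProperties +-commutativeSemigroup using (interchange; x∙yz≈y∙xz)
  open MonoidSum +-monoid using (sum⁺-syntax)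
  open SetoidReasoning setoid

  -- The coefficient of zⁿ is the value at n.
  Series : Set c
  Series = ℕ → Carrier

  infix 4 _≋_
  _≋_ : Series → Series → Set ℓ₁
  a ≋ b = ∀ n → a n ≈ b n

  infixl 6 _⊕_
  infixl 7 _⊛_
  infix  8 ⊖_

  _⊕_ _⊛_ : Series → Series → Series
  (a ⊕ b) n = a n + b n
  (a ⊛ b) n = ∑[ k ≤ n ] (a (toℕ k) * b (n ∸ toℕ k))

  ⊖_ : Series → Series
  (⊖ a) n = - a n

  𝟘 𝟙 𝕫 : Series
  𝟘 _ = 0#

  𝟙 zero    = 1#
  𝟙 (suc _) = 0#

  𝕫 zero          = 0#
  𝕫 (suc zero)    = 1#
  𝕫 (suc (suc _)) = 0#

  tail : Series → Series
  tail a n = a (suc n)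

  ⊛-suc : ∀ a b n → (a ⊛ b) (suc n) ≡ a 0 * b (suc n) + (tail a ⊛ b) n
  ⊛-suc a b n = ≡.refl

  ⊛-zero : ∀ a b → (a ⊛ b) 0 ≈ a 0 * b 0
  ⊛-zero a b = +-identityʳ (a 0 * b 0)

  ⊛-cong : ∀ {a a′ b b′} → a ≋ a′ → b ≋ b′ → a ⊛ b ≋ a′ ⊛ b′
  ⊛-cong p q zero    = +-congʳ (*-cong (p 0) (q 0))
  ⊛-cong p q (suc n) = +-cong (*-cong (p 0) (q (suc n))) (⊛-cong (λ k → p (suc k)) q n)

  ⊛-distribʳ : ∀ c a b → (a ⊕ b) ⊛ c ≋ (a ⊛ c) ⊕ (b ⊛ c)
  ⊛-distribʳ c a b zero = begin
    ((a ⊕ b) ⊛ c) 0            ≈⟨ ⊛-zero (a ⊕ b) c ⟩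
    (a 0 + b 0) * c 0          ≈⟨ distribʳ (c 0) (a 0) (b 0) ⟩
    a 0 * c 0 + b 0 * c 0      ≈⟨ +-cong (⊛-zero a c) (⊛-zero b c) ⟨
    (a ⊛ c) 0 + (b ⊛ c) 0      ∎
  ⊛-distribʳ c a b (suc n) = begin
    (a 0 + b 0) * c (suc n) + ((tail a ⊕ tail b) ⊛ c) n
      ≈⟨ +-cong (distribʳ (c (suc n)) (a 0) (b 0)) (⊛-distribʳ c (tail a) (tail b) n) ⟩
    (a 0 * c (suc n) + b 0 * c (suc n)) + ((tail a ⊛ c) n + (tail b ⊛ c) n)
      ≈⟨ interchange (a 0 * c (suc n)) (b 0 * c (suc n)) ((tail a ⊛ c) n) ((tail b ⊛ c) n) ⟩
    (a ⊛ c) (suc n) + (b ⊛ c) (suc n) ∎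

  ⊛-sucʳ : ∀ a b n → (a ⊛ b) (suc n) ≈ (a ⊛ tail b) n + a (suc n) * b 0
  ⊛-sucʳ a b zero    = begin
    a 0 * b 1 + (tail a ⊛ b) 0      ≈⟨ +-cong (sym (⊛-zero a (tail b))) (⊛-zero (tail a) b) ⟩
    (a ⊛ tail b) 0 + a 1 * b 0      ∎
  ⊛-sucʳ a b (suc n) = begin
    a 0 * b (suc (suc n)) + (tail a ⊛ b) (suc n)
      ≈⟨ +-congˡ (⊛-sucʳ (tail a) b n) ⟩
    a 0 * b (suc (suc n)) + ((tail a ⊛ tail b) n + a (suc (suc n)) * b 0)
      ≈⟨ +-assoc _ _ _ ⟨
    (a ⊛ tail b) (suc n) + a (suc (suc n)) * b 0 ∎

  ⊛-comm : ∀ a b → a ⊛ b ≋ b ⊛ a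
  ⊛-comm a b zero    = +-congʳ (*-comm (a 0) (b 0))
  ⊛-comm a b (suc n) = begin
    a 0 * b (suc n) + (tail a ⊛ b) n  ≈⟨ +-cong (*-comm (a 0) (b (suc n))) (⊛-comm (tail a) b n) ⟩
    b (suc n) * a 0 + (b ⊛ tail a) n  ≈⟨ +-comm _ _ ⟩
    (b ⊛ tail a) n + b (suc n) * a 0  ≈⟨ ⊛-sucʳ b a n ⟨
    (b ⊛ a) (suc n)                   ∎

  ⊛-scale : ∀ x a b n → ((λ k → x * a k) ⊛ b) n ≈ x * (a ⊛ b) n
  ⊛-scale x a b zero    = begin
    ((λ k → x * a k) ⊛ b) 0   ≈⟨ ⊛-zero (λ k → x * a k) b ⟩
    x * a 0 * b 0             ≈⟨ *-assoc x (a 0) (b 0) ⟩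
    x * (a 0 * b 0)           ≈⟨ *-congˡ (⊛-zero a b) ⟨
    x * (a ⊛ b) 0             ∎
  ⊛-scale x a b (suc n) = begin
    x * a 0 * b (suc n) + ((λ k → x * tail a k) ⊛ b) n
      ≈⟨ +-cong (*-assoc x (a 0) (b (suc n))) (⊛-scale x (tail a) b n) ⟩
    x * (a 0 * b (suc n)) + x * (tail a ⊛ b) n
      ≈⟨ distribˡ x _ _ ⟨
    x * (a ⊛ b) (suc n) ∎

  ⊛-assoc : ∀ a b c → (a ⊛ b) ⊛ c ≋ a ⊛ (b ⊛ c)
  ⊛-assoc a b c zero    = begin
    ((a ⊛ b) ⊛ c) 0        ≈⟨ ⊛-zero (a ⊛ b) c ⟩
    (a ⊛ b) 0 * c 0        ≈⟨ *-congʳ (⊛-zero a b) ⟩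
    a 0 * b 0 * c 0        ≈⟨ *-assoc (a 0) (b 0) (c 0) ⟩
    a 0 * (b 0 * c 0)      ≈⟨ *-congˡ (⊛-zero b c) ⟨
    a 0 * (b ⊛ c) 0        ≈⟨ ⊛-zero a (b ⊛ c) ⟨
    (a ⊛ (b ⊛ c)) 0        ∎
  ⊛-assoc a b c (suc n) = begin
    (a ⊛ b) 0 * c (suc n) + (((λ k → a 0 * tail b k) ⊕ (tail a ⊛ b)) ⊛ c) n
      ≈⟨ +-cong (trans (*-congʳ (⊛-zero a b)) (*-assoc (a 0) (b 0) (c (suc n))))
                (⊛-distribʳ c (λ k → a 0 * tail b k) (tail a ⊛ b) n) ⟩
    a 0 * (b 0 * c (suc n)) + (((λ k → a 0 * tail b k) ⊛ c) n + ((tail a ⊛ b) ⊛ c) n)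
      ≈⟨ +-congˡ (+-cong (⊛-scale (a 0) (tail b) c n) (⊛-assoc (tail a) b c n)) ⟩
    a 0 * (b 0 * c (suc n)) + (a 0 * (tail b ⊛ c) n + (tail a ⊛ (b ⊛ c)) n)
      ≈⟨ +-assoc _ _ _ ⟨
    (a 0 * (b 0 * c (suc n)) + a 0 * (tail b ⊛ c) n) + (tail a ⊛ (b ⊛ c)) n
      ≈⟨ +-congʳ (distribˡ (a 0) _ _) ⟨
    a 0 * (b ⊛ c) (suc n) + (tail a ⊛ (b ⊛ c)) n ∎

  ⊛-zeroˡ : ∀ a → 𝟘 ⊛ a ≋ 𝟘
  ⊛-zeroˡ a zero    = trans (⊛-zero 𝟘 a) (zeroˡ (a 0))
  ⊛-zeroˡ a (suc n) = trans (+-cong (zeroˡ (a (suc n))) (⊛-zeroˡ a n)) (+-identityʳ 0#)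

  ⊛-identityˡ : ∀ a → 𝟙 ⊛ a ≋ a
  ⊛-identityˡ a zero    = trans (⊛-zero 𝟙 a) (*-identityˡ (a 0))
  ⊛-identityˡ a (suc n) = trans (+-cong (*-identityˡ (a (suc n))) (⊛-zeroˡ a n)) (+-identityʳ (a (suc n)))

  ⊛-identityʳ : ∀ a → a ⊛ 𝟙 ≋ a
  ⊛-identityʳ a n = trans (⊛-comm a 𝟙 n) (⊛-identityˡ a n)

  seriesRing : CommutativeRing c ℓ₁
  seriesRing = record
    { Carrier = Series
    ; _≈_     = _≋_
    ; _+_     = _⊕_
    ; _*_     = _⊛_
    ; -_      = ⊖_
    ; 0#      = 𝟘
    ; 1#      = 𝟙
    ; isCommutativeRing = record
      { isRing = record
        { +-isAbelianGroup = record
          { isGroup = record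
            { isMonoid = record
              { isSemigroup = record
                { isMagma = record
                  { isEquivalence = record
                    { refl  = λ n → refl
                    ; sym   = λ p n → sym (p n)
                    ; trans = λ p q n → trans (p n) (q n)
                    }
                  ; ∙-cong = λ p q n → +-cong (p n) (q n)
                  }
                ; assoc = λ a b c n → +-assoc (a n) (b n) (c n)
                }
              ; identity = (λ a n → +-identityˡ (a n)) , (λ a n → +-identityʳ (a n))
              }
            ; inverse = (λ a n → -‿inverseˡ (a n)) , (λ a n → -‿inverseʳ (a n))
            ; ⁻¹-cong = λ p n → -‿cong (p n)
            }
          ; comm = λ a b n → +-comm (a n) (b n)
          }
        ; *-cong     = ⊛-cong
        ; *-assoc    = ⊛-assoc
        ; *-identity = ⊛-identityˡ , ⊛-identityʳ
        ; distrib    =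
            (λ a b c n → trans (⊛-comm a (b ⊕ c) n)
              (trans (⊛-distribʳ a b c n) (+-cong (⊛-comm b a n) (⊛-comm c a n)))) ,
            ⊛-distribʳ
        }
      ; *-comm = ⊛-comm
      }
    }

  open SemiringExp (CommutativeRing.semiring seriesRing) public using (_^_)

  -- Long division c/a, where u is the inverse of the constant term of a.
  quotient : Carrier → Series → Series → Series
  quotient u a c zero    = c 0 * u
  quotient u a c (suc n) = quotient u a (λ k → c (suc k) - c 0 * u * a (suc k)) n

  quotient-⊛ : ∀ u a → u * a 0 ≈ 1# → ∀ c → quotient u a c ⊛ a ≋ c
  quotient-⊛ u a ua≈1 c zero    = begin
    (quotient u a c ⊛ a) 0   ≈⟨ ⊛-zero (quotient u a c) a ⟩
    c 0 * u * a 0            ≈⟨ *-assoc (c 0) u (a 0) ⟩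
    c 0 * (u * a 0)          ≈⟨ *-congˡ ua≈1 ⟩
    c 0 * 1#                 ≈⟨ *-identityʳ (c 0) ⟩
    c 0                      ∎
  quotient-⊛ u a ua≈1 c (suc n) = begin
    t + (quotient u a (λ k → c (suc k) - c 0 * u * a (suc k)) ⊛ a) n
      ≈⟨ +-congˡ (quotient-⊛ u a ua≈1 (λ k → c (suc k) - c 0 * u * a (suc k)) n) ⟩
    t + (c (suc n) - t)      ≈⟨ x∙yz≈y∙xz t (c (suc n)) (- t) ⟩
    c (suc n) + (t - t)      ≈⟨ +-congˡ (-‿inverseʳ t) ⟩
    c (suc n) + 0#           ≈⟨ +-identityʳ (c (suc n)) ⟩
    c (suc n)                ∎
    where
    t : Carrier
    t = c 0 * u * a (suc n)

  -- "Nonzero" is apartness from 0#, as usual in a Heyting field: it is what makes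
  -- series with nonzero constant term invertible, and tightness makes it
  -- classically the same as ¬ (_ ≈ 0#).
  record F₀ : Set (c ⊔ ℓ₂) where
    field
      series  : Series
      const#0 : series 0 # 0#
  open F₀ public

  infix 4 _≋₀_
  _≋₀_ : F₀ → F₀ → Set ℓ₁
  g ≋₀ h = series g ≋ series h

  𝟙₀ : F₀
  𝟙₀ = record { series = 𝟙 ; const#0 = 1#0 }

  infixl 7 _⊛₀_
  _⊛₀_ : F₀ → F₀ → F₀
  g ⊛₀ h = record
    { series  = series g ⊛ series h
    ; const#0 = #-congʳ (sym (⊛-zero (series g) (series h))) (x#0y#0→xy#0 (const#0 g) (const#0 h))
    }

  constInverse : (g : F₀) → Carrier
  constInverse g = proj₁ (#⇒invertible (const#0 g))

  constInverse-* : ∀ g → constInverse g * series g 0 ≈ 1#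
  constInverse-* g = trans (*-congˡ (sym (x-0≈x (series g 0)))) (proj₁ (proj₂ (#⇒invertible (const#0 g))))

  infix 8 _⁻¹₀
  _⁻¹₀ : F₀ → F₀
  g ⁻¹₀ = record
    { series  = quotient (constInverse g) (series g) 𝟙
    ; const#0 = invertibleˡ⇒# (series g 0 , (begin
        series g 0 * (1# * constInverse g - 0#)  ≈⟨ *-congˡ (trans (x-0≈x _) (*-identityˡ _)) ⟩
        series g 0 * constInverse g              ≈⟨ *-comm _ _ ⟩
        constInverse g * series g 0              ≈⟨ constInverse-* g ⟩
        1#                                       ∎))
    }

  ⁻¹₀-inverseˡ : ∀ g → g ⁻¹₀ ⊛₀ g ≋₀ 𝟙₀
  ⁻¹₀-inverseˡ g = quotient-⊛ (constInverse g) (series g) (constInverse-* g) 𝟙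

  ⁻¹₀-inverseʳ : ∀ g → g ⊛₀ g ⁻¹₀ ≋₀ 𝟙₀
  ⁻¹₀-inverseʳ g n = trans (⊛-comm (series g) (series (g ⁻¹₀)) n) (⁻¹₀-inverseˡ g n)

  ⁻¹₀-cong : ∀ {g h} → g ≋₀ h → g ⁻¹₀ ≋₀ h ⁻¹₀
  ⁻¹₀-cong {g} {h} g≋h = R.begin
    g⁻¹                        R.≈⟨ ⊛-identityʳ g⁻¹ ⟨
    g⁻¹ ⊛ 𝟙                    R.≈⟨ ⊛-cong {a = g⁻¹} {b = series h ⊛ h⁻¹} (λ _ → refl) (⁻¹₀-inverseʳ h) ⟨
    g⁻¹ ⊛ (series h ⊛ h⁻¹)     R.≈⟨ ⊛-assoc g⁻¹ (series h) h⁻¹ ⟨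
    g⁻¹ ⊛ series h ⊛ h⁻¹       R.≈⟨ ⊛-cong {b = h⁻¹} (⊛-cong {a = g⁻¹} (λ _ → refl) g≋h) (λ _ → refl) ⟨
    g⁻¹ ⊛ series g ⊛ h⁻¹       R.≈⟨ ⊛-cong {a = g⁻¹ ⊛ series g} {b = h⁻¹} (⁻¹₀-inverseˡ g) (λ _ → refl) ⟩
    𝟙 ⊛ h⁻¹                    R.≈⟨ ⊛-identityˡ h⁻¹ ⟩
    h⁻¹                        R.∎
    where
    module R = SetoidReasoning (CommutativeRing.setoid seriesRing)
    g⁻¹ h⁻¹ : Series
    g⁻¹ = series (g ⁻¹₀)
    h⁻¹ = series (h ⁻¹₀)

  F₀-group : Group (c ⊔ ℓ₂) ℓ₁
  F₀-group = record
    { Carrier = F₀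
    ; _≈_     = _≋₀_
    ; _∙_     = _⊛₀_
    ; ε       = 𝟙₀
    ; _⁻¹     = _⁻¹₀
    ; isGroup = record
      { isMonoid = record
        { isSemigroup = record
          { isMagma = record
            { isEquivalence = record
              { refl  = λ n → refl
              ; sym   = λ p n → sym (p n)
              ; trans = λ p q n → trans (p n) (q n)
              }
            ; ∙-cong = ⊛-cong
            }
          ; assoc = λ g h k → ⊛-assoc (series g) (series h) (series k)
          }
        ; identity = (λ g → ⊛-identityˡ (series g)) , (λ g → ⊛-identityʳ (series g))
        }
      ; inverse = ⁻¹₀-inverseˡ , ⁻¹₀-inverseʳ
      ; ⁻¹-cong = λ {g} {h} → ⁻¹₀-cong {g} {h}
      }
    }

  record F₁ : Set (c ⊔ ℓ₁ ⊔ ℓ₂) where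
    field
      series₁  : Series
      const≈0  : series₁ 0 ≈ 0#
      linear#0 : series₁ 1 # 0#
  open F₁ public

  infix 4 _≋₁_
  _≋₁_ : F₁ → F₁ → Set ℓ₁
  f ≋₁ l = series₁ f ≋ series₁ l

  𝕫₁ : F₁
  𝕫₁ = record { series₁ = 𝕫 ; const≈0 = refl ; linear#0 = 1#0 }

  neg-#0 : ∀ {x} → x # 0# → - x # 0#
  neg-#0 {x} x#0 = #-congʳ (-1*x≈-x x) (x#0y#0→xy#0 -1#0 x#0)
    where
    -1#0 : - 1# # 0#
    -1#0 = invertibleˡ⇒# (- 1# ,
      trans (*-congˡ (x-0≈x (- 1#))) (trans (-1*x≈-x (- 1#)) (-‿involutive 1#)))

  infix 8 ⊖₁_
  ⊖₁_ : F₁ → F₁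
  ⊖₁ f = record
    { series₁  = ⊖ series₁ f
    ; const≈0  = trans (-‿cong (const≈0 f)) -0#≈0#
    ; linear#0 = neg-#0 (linear#0 f)
    }

  -- h(f(z)): since f has no constant term, fᵏ contributes to the coefficient
  -- of zⁿ only for k ≤ n.
  infixr 9 _⊚_
  _⊚_ : Series → F₁ → Series
  (h ⊚ f) n = ∑[ k ≤ n ] (h (toℕ k) * (series₁ f ^ toℕ k) n)

  ⊚-const : ∀ h f → (h ⊚ f) 0 ≈ h 0
  ⊚-const h f = trans (+-identityʳ (h 0 * 1#)) (*-identityʳ (h 0))

  ⊚-linear : ∀ l f → (series₁ l ⊚ f) 1 ≈ series₁ l 1 * series₁ f 1
  ⊚-linear l f = begin
    series₁ l 0 * 0# + (series₁ l 1 * (series₁ f ⊛ 𝟙) 1 + 0#)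
      ≈⟨ +-cong (zeroʳ (series₁ l 0)) (+-identityʳ _) ⟩
    0# + series₁ l 1 * (series₁ f ⊛ 𝟙) 1
      ≈⟨ +-identityˡ _ ⟩
    series₁ l 1 * (series₁ f ⊛ 𝟙) 1
      ≈⟨ *-congˡ (⊛-identityʳ (series₁ f) 1) ⟩
    series₁ l 1 * series₁ f 1 ∎

  infixr 9 _⊚₀_ _⊚₁_
  _⊚₀_ : F₀ → F₁ → F₀
  h ⊚₀ f = record
    { series  = series h ⊚ f
    ; const#0 = #-congʳ (sym (⊚-const (series h) f)) (const#0 h)
    }

  _⊚₁_ : F₁ → F₁ → F₁
  l ⊚₁ f = record
    { series₁  = series₁ l ⊚ f
    ; const≈0  = trans (⊚-const (series₁ l) f) (const≈0 l)
    ; linear#0 = #-congʳ (sym (⊚-linear l f)) (x#0y#0→xy#0 (linear#0 l) (linear#0 f))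
    }

  record Riordan : Set (c ⊔ ℓ₁ ⊔ ℓ₂) where
    constructor ⟪_,_⟫
    field
      g : F₀
      f : F₁

  infix 4 _≈ᴿ_
  _≈ᴿ_ : Riordan → Riordan → Set ℓ₁
  ⟪ g , f ⟫ ≈ᴿ ⟪ h , l ⟫ = g ≋₀ h × f ≋₁ l

  infixl 7 _*ᴿ_
  _*ᴿ_ : Riordan → Riordan → Riordan
  ⟪ g , f ⟫ *ᴿ ⟪ h , l ⟫ = ⟪ g ⊛₀ (h ⊚₀ f) , l ⊚₁ f ⟫

  Iᴿ M : Riordan
  Iᴿ = ⟪ 𝟙₀ , 𝕫₁ ⟫
  M  = ⟪ 𝟙₀ , ⊖₁ 𝕫₁ ⟫

  IsPseudoInvolution : Riordan → Set ℓ₁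
  IsPseudoInvolution L = (L *ᴿ M) *ᴿ (L *ᴿ M) ≈ᴿ Iᴿ

record IsSubgroup {c ℓ p : Level} (G : Group c ℓ) (H : Pred (Group.Carrier G) p) : Set (c ⊔ ℓ ⊔ p) where
  open Group G
  field
    respects-≈ : H Respects _≈_
    ε-closed   : ε ∈ H
    ∙-closed   : ∀ {x y} → x ∈ H → y ∈ H → x ∙ y ∈ H
    ⁻¹-closed  : ∀ {x} → x ∈ H → x ⁻¹ ∈ H

subsetSetoid : ∀ {c ℓ p} (S : Setoid c ℓ) → Pred (Setoid.Carrier S) p → Setoid (c ⊔ p) ℓ
subsetSetoid S P = On.setoid {B = Σ (Setoid.Carrier S) P} S proj₁

-- A setoid is infinite when it contains a sequence of pairwise distinct elements.
Infinite : ∀ {c ℓ} → Setoid c ℓ → Set (c ⊔ ℓ)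
Infinite S = Injection (≡.setoid ℕ) S

open PowerSeries Complex.ℂ-field public

{-# OPTIONS --safe #-}

-- Put w = -f.  Since (g, f) * M = (g, w) and w is an involution, (g, f) is a
-- pseudo-involution iff g · g(w) = 1.  Substitution of w is a ring homomorphism,
-- so such g form a subgroup.  As w(w) = z, it contains every quotient h / h(w), in
-- particular (1 + n z) / (1 + n w) = 1 + n (1 - w₁) z + ⋯.  These are distinct
-- because w₁ ≠ 1: indeed w₁² = 1, and w₁ = 1 would force w = z.
module Submission where

open import Algebra.Apartness.Bundles using (HeytingField)
import Algebra.Apartness.Properties.HeytingCommutativeRing as HeytingProperties
open import Algebra.Bundles using (CommutativeRing; Group)
import Algebra.Definitions.RawMonoid as RawMonoidDefinitions
import Algebra.Properties.CommutativeSemigroup as CommutativeSemigroupProperties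
import Algebra.Properties.Monoid.Sum as MonoidSum
import Algebra.Properties.Ring as RingProperties
import Algebra.Properties.Semiring.Exp as SemiringExp
open import Data.Fin.Base using (toℕ)
open import Data.Nat.Base using (ℕ; zero; suc; _∸_; _≤_; _<_; z≤n; s≤s; s<s)
open import Data.Nat.Induction using (<-rec)
import Data.Nat.Properties as ℕ
open import Data.Product.Base using (_×_; _,_)
open import Data.Sum.Base using (inj₁; inj₂)
open import Level using (Level)
import Relation.Binary.PropositionalEquality as ≡
open ≡ using (_≡_)
import Relation.Binary.Reasoning.Setoid as SetoidReasoning
open import Relation.Nullary using (¬_; contradiction)
open import Relation.Unary using (Pred)
import Defs
open Defs using (IsSubgroup)

isSubgroup-resp-⇔ : ∀ {c ℓ p q} (G : Group c ℓ) {P : Pred (Group.Carrier G) p} {Q : Pred (Group.Carrier G) q} →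
                    (∀ x → P x → Q x) → (∀ x → Q x → P x) → IsSubgroup G P → IsSubgroup G Q
isSubgroup-resp-⇔ G to from isSubgroup = record
  { respects-≈ = λ {x} {y} x≈y x∈Q → to y (respects-≈ x≈y (from x x∈Q))
  ; ε-closed   = to _ ε-closed
  ; ∙-closed   = λ {x} {y} x∈Q y∈Q → to _ (∙-closed (from x x∈Q) (from y y∈Q))
  ; ⁻¹-closed  = λ {x} x∈Q → to _ (⁻¹-closed (from x x∈Q))
  }
  where open IsSubgroup isSubgroup

module Substitution {c ℓ₁ ℓ₂ : Level} (K : HeytingField c ℓ₁ ℓ₂) where

  open Defs.PowerSeries K
  open HeytingField K using (_#_; #-irrefl; #-cotrans; #⇒invertible; heytingCommutativeRing)
  open HeytingProperties heytingCommutativeRing using (1#0; #-congʳ; x-0≈x; invertibleˡ⇒#)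
  open CommutativeRing coefficientRing
  open RingProperties ring
  open MonoidSum +-monoid using (sum⁺-syntax)
  open CommutativeSemigroupProperties +-commutativeSemigroup using (interchange)
  open SetoidReasoning setoid

  module 𝓢 = CommutativeRing seriesRing
  open CommutativeSemigroupProperties 𝓢.*-commutativeSemigroup
    using () renaming (interchange to ⊛-interchange)
  module ≋-Reasoning = SetoidReasoning 𝓢.setoid

  -- Finite sums of coefficients.

  infixr 7 _∙_
  _∙_ : Carrier → Series → Series
  (x ∙ a) n = x * a n

  ∑≤ : ℕ → Series → Carrier
  ∑≤ n c = ∑[ k ≤ n ] c (toℕ k)

  ∑≤-cong : ∀ n c d → (∀ k → k ≤ n → c k ≈ d k) → ∑≤ n c ≈ ∑≤ n d
  ∑≤-cong zero    c d p = +-congʳ (p 0 z≤n)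
  ∑≤-cong (suc n) c d p = +-cong (p 0 z≤n) (∑≤-cong n (tail c) (tail d) λ k k≤n → p (suc k) (s≤s k≤n))

  ∑≤-⊕ : ∀ n c d → ∑≤ n (c ⊕ d) ≈ ∑≤ n c + ∑≤ n d
  ∑≤-⊕ zero    c d = trans (+-congˡ (sym (+-identityʳ 0#))) (interchange (c 0) (d 0) 0# 0#)
  ∑≤-⊕ (suc n) c d = trans (+-congˡ (∑≤-⊕ n (tail c) (tail d))) (interchange (c 0) (d 0) _ _)

  ∑≤-∙ : ∀ n x c → ∑≤ n (x ∙ c) ≈ x * ∑≤ n c
  ∑≤-∙ zero    x c = trans (+-congˡ (sym (zeroʳ x))) (sym (distribˡ x (c 0) 0#))
  ∑≤-∙ (suc n) x c = trans (+-congˡ (∑≤-∙ n x (tail c))) (sym (distribˡ x (c 0) _))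

  ∑≤-𝟘 : ∀ n → ∑≤ n 𝟘 ≈ 0#
  ∑≤-𝟘 zero    = +-identityˡ 0#
  ∑≤-𝟘 (suc n) = trans (+-identityˡ _) (∑≤-𝟘 n)

  ∑≤-last : ∀ n c → (∀ k → k < n → c k ≈ 0#) → ∑≤ n c ≈ c n
  ∑≤-last zero    c p = +-identityʳ (c 0)
  ∑≤-last (suc n) c p = begin
    c 0 + ∑≤ n (tail c)  ≈⟨ +-cong (p 0 (s≤s z≤n)) (∑≤-last n (tail c) λ k k<n → p (suc k) (s<s k<n)) ⟩
    0# + c (suc n)       ≈⟨ +-identityˡ (c (suc n)) ⟩
    c (suc n)            ∎

  -- Reconciles two bounds: `_⊚_` sums up to the degree in question, while `∑≤-⊛` needs one bound
  -- common to all degrees of the left factor.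
  ∑≤-truncate : ∀ {m n} c → m ≤ n → (∀ k → m < k → c k ≈ 0#) → ∑≤ n c ≈ ∑≤ m c
  ∑≤-truncate {n = zero}  c z≤n       p = refl
  ∑≤-truncate {n = suc n} c z≤n       p = +-congˡ
    (trans (∑≤-cong n (tail c) 𝟘 λ k _ → p (suc k) (s≤s z≤n)) (∑≤-𝟘 n))
  ∑≤-truncate             c (s≤s m≤n) p = +-congˡ (∑≤-truncate (tail c) m≤n λ k m<k → p (suc k) (s<s m<k))

  -- A coefficient of a product involves only coefficients of the left factor of at most its own
  -- degree. Equality up to degree n is all that an induction on the degree can supply.
  ⊛-congˡ-≤ : ∀ {n a b} c → (∀ k → k ≤ n → a k ≈ b k) → (a ⊛ c) n ≈ (b ⊛ c) n
  ⊛-congˡ-≤ {n} {a} {b} c p =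
    ∑≤-cong n (λ k → a k * c (n ∸ k)) (λ k → b k * c (n ∸ k)) λ k k≤n → *-congʳ (p k k≤n)

  -- The bound `N` does not vary with `m`, so the left factor is a genuine finite linear combination
  -- of series and multiplication by `a` acts termwise.
  ∑≤-⊛ : ∀ N c (p : ℕ → Series) a n →
         ((λ m → ∑≤ N λ k → c k * p k m) ⊛ a) n ≈ ∑≤ N λ k → c k * (p k ⊛ a) n
  ∑≤-⊛ zero c p a n = begin
    ((λ m → c 0 * p 0 m + 0#) ⊛ a) n  ≈⟨ ⊛-congˡ-≤ {n} a (λ m _ → +-identityʳ (c 0 * p 0 m)) ⟩
    ((c 0 ∙ p 0) ⊛ a) n               ≈⟨ ⊛-scale (c 0) (p 0) a n ⟩
    c 0 * (p 0 ⊛ a) n                 ≈⟨ +-identityʳ _ ⟨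
    c 0 * (p 0 ⊛ a) n + 0#            ∎
  ∑≤-⊛ (suc N) c p a n = trans
    (⊛-distribʳ a (c 0 ∙ p 0) (λ m → ∑≤ N λ k → c (suc k) * p (suc k) m) n)
    (+-cong (⊛-scale (c 0) (p 0) a n) (∑≤-⊛ N (tail c) (λ k → p (suc k)) a n))

  -- Powers of a series without constant term.

  -- A series without constant term is z times its tail, so one factor z can be split off the power
  -- and cancelled.
  ^-suc-coeff : ∀ f k n → (series₁ f ^ suc k) (suc n) ≈ ((series₁ f ^ k) ⊛ tail (series₁ f)) n
  ^-suc-coeff f k n = begin
    series₁ f 0 * (series₁ f ^ k) (suc n) + (tail (series₁ f) ⊛ (series₁ f ^ k)) n
      ≈⟨ +-cong (trans (*-congʳ (const≈0 f)) (zeroˡ _)) (⊛-comm (tail (series₁ f)) (series₁ f ^ k) n) ⟩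
    0# + ((series₁ f ^ k) ⊛ tail (series₁ f)) n
      ≈⟨ +-identityˡ _ ⟩
    ((series₁ f ^ k) ⊛ tail (series₁ f)) n ∎

  -- Each factor contributes at least one z; the induction strips one factor together with one
  -- degree.
  ^-coeff-< : ∀ f {k n} → n < k → (series₁ f ^ k) n ≈ 0#
  ^-coeff-< f {suc k} {zero}  _         = begin
    (series₁ f ^ suc k) 0            ≈⟨ ⊛-zero (series₁ f) (series₁ f ^ k) ⟩
    series₁ f 0 * (series₁ f ^ k) 0  ≈⟨ *-congʳ (const≈0 f) ⟩
    0# * (series₁ f ^ k) 0           ≈⟨ zeroˡ _ ⟩
    0#                               ∎
  ^-coeff-< f {suc k} {suc n} (s≤s n<k) = begin
    (series₁ f ^ suc k) (suc n)             ≈⟨ ^-suc-coeff f k n ⟩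
    ((series₁ f ^ k) ⊛ tail (series₁ f)) n  ≈⟨ ⊛-congˡ-≤ {n} (tail (series₁ f)) (λ m m≤n → ^-coeff-< f (ℕ.≤-<-trans m≤n n<k)) ⟩
    (𝟘 ⊛ tail (series₁ f)) n                ≈⟨ ⊛-zeroˡ (tail (series₁ f)) n ⟩
    0#                                      ∎

  -- In the convolution of fⁿ with the tail of f, every term below the top index vanishes because fⁿ
  -- is divisible by zⁿ. What is left is a product of leading coefficients.
  ^-coeff-1 : ∀ f → series₁ f 1 ≈ 1# → ∀ n → (series₁ f ^ n) n ≈ 1#
  ^-coeff-1 f f₁≈1 zero    = refl
  ^-coeff-1 f f₁≈1 (suc n) = begin
    (series₁ f ^ suc n) (suc n)                   ≈⟨ ^-suc-coeff f n n ⟩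
    ((series₁ f ^ n) ⊛ tail (series₁ f)) n        ≈⟨ ∑≤-last n (λ k → (series₁ f ^ n) k * series₁ f (suc (n ∸ k)))
                                                       (λ k k<n → trans (*-congʳ (^-coeff-< f k<n)) (zeroˡ _)) ⟩
    (series₁ f ^ n) n * series₁ f (suc (n ∸ n))   ≈⟨ *-cong (^-coeff-1 f f₁≈1 n) (reflexive (≡.cong (λ i → series₁ f (suc i)) (ℕ.n∸n≡0 n))) ⟩
    1# * series₁ f 1                              ≈⟨ *-identityˡ _ ⟩
    series₁ f 1                                   ≈⟨ f₁≈1 ⟩
    1#                                            ∎

  -- Substitution as a ring homomorphism.

  ⊚-summand : Series → F₁ → ℕ → Series
  ⊚-summand a f n k = a k * (series₁ f ^ k) n

  ⊚-cong : ∀ {a b f l} → a ≋ b → f ≋₁ l → a ⊚ f ≋ b ⊚ l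
  ⊚-cong {a} {b} {f} {l} a≋b f≋l n =
    ∑≤-cong n (⊚-summand a f n) (⊚-summand b l n) λ k _ → *-cong (a≋b k) (^-congˡ k f≋l n)
    where open SemiringExp 𝓢.semiring using (^-congˡ)

  ⊚-congʳ : ∀ {a b} f → a ≋ b → a ⊚ f ≋ b ⊚ f
  ⊚-congʳ {a} {b} f a≋b = ⊚-cong {a} {b} {f} {f} a≋b λ _ → refl

  ⊚-⊕ : ∀ a b f → (a ⊕ b) ⊚ f ≋ (a ⊚ f) ⊕ (b ⊚ f)
  ⊚-⊕ a b f n = trans
    (∑≤-cong n (⊚-summand (a ⊕ b) f n) (⊚-summand a f n ⊕ ⊚-summand b f n) λ k _ → distribʳ _ (a k) (b k))
    (∑≤-⊕ n (⊚-summand a f n) (⊚-summand b f n))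

  ⊚-∙ : ∀ x a f → (x ∙ a) ⊚ f ≋ x ∙ (a ⊚ f)
  ⊚-∙ x a f n = trans
    (∑≤-cong n (⊚-summand (x ∙ a) f n) (x ∙ ⊚-summand a f n) λ k _ → *-assoc x (a k) _)
    (∑≤-∙ n x (⊚-summand a f n))

  ⊚-⊖ : ∀ a f → (⊖ a) ⊚ f ≋ ⊖ (a ⊚ f)
  ⊚-⊖ a f n = begin
    ((⊖ a) ⊚ f) n         ≈⟨ ⊚-congʳ f (λ k → sym (-1*x≈-x (a k))) n ⟩
    ((- 1# ∙ a) ⊚ f) n    ≈⟨ ⊚-∙ (- 1#) a f n ⟩
    - 1# * (a ⊚ f) n      ≈⟨ -1*x≈-x _ ⟩
    - (a ⊚ f) n           ∎

  -- Horner's rule a(f) = a₀ + f · (tail a)(f), with one factor z cancelled.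
  ⊚-suc : ∀ a f n → (a ⊚ f) (suc n) ≈ ((tail a ⊚ f) ⊛ tail (series₁ f)) n
  ⊚-suc a f n = begin
    a 0 * 0# + ∑≤ n (λ k → a (suc k) * (series₁ f ^ suc k) (suc n))
      ≈⟨ +-cong (zeroʳ (a 0)) (∑≤-cong n
           (λ k → a (suc k) * (series₁ f ^ suc k) (suc n)) (λ k → a (suc k) * ((series₁ f ^ k) ⊛ tail (series₁ f)) n)
           λ k _ → *-congˡ (^-suc-coeff f k n)) ⟩
    0# + ∑≤ n (λ k → a (suc k) * ((series₁ f ^ k) ⊛ tail (series₁ f)) n)
      ≈⟨ +-identityˡ _ ⟩
    ∑≤ n (λ k → a (suc k) * ((series₁ f ^ k) ⊛ tail (series₁ f)) n)
      ≈⟨ ∑≤-⊛ n (tail a) (series₁ f ^_) (tail (series₁ f)) n ⟨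
    ((λ m → ∑≤ n λ k → a (suc k) * (series₁ f ^ k) m) ⊛ tail (series₁ f)) n
      ≈⟨ ⊛-congˡ-≤ {n} {b = tail a ⊚ f} (tail (series₁ f)) (λ m m≤n → ∑≤-truncate (⊚-summand (tail a) f m) m≤n λ k m<k →
           trans (*-congˡ (^-coeff-< f m<k)) (zeroʳ _)) ⟩
    ((tail a ⊚ f) ⊛ tail (series₁ f)) n ∎

  𝟘-⊚ : ∀ f → 𝟘 ⊚ f ≋ 𝟘
  𝟘-⊚ f n = trans (∑≤-cong n (⊚-summand 𝟘 f n) 𝟘 λ k _ → zeroˡ _) (∑≤-𝟘 n)

  𝟙-⊚ : ∀ f → 𝟙 ⊚ f ≋ 𝟙
  𝟙-⊚ f zero    = ⊚-const 𝟙 f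
  𝟙-⊚ f (suc n) = begin
    (𝟙 ⊚ f) (suc n)                    ≈⟨ ⊚-suc 𝟙 f n ⟩
    ((𝟘 ⊚ f) ⊛ tail (series₁ f)) n     ≈⟨ ⊛-congˡ-≤ {n} (tail (series₁ f)) (λ m _ → 𝟘-⊚ f m) ⟩
    (𝟘 ⊛ tail (series₁ f)) n           ≈⟨ ⊛-zeroˡ (tail (series₁ f)) n ⟩
    0#                                 ∎

  𝕫-⊚ : ∀ f → 𝕫 ⊚ f ≋ series₁ f
  𝕫-⊚ f zero    = trans (⊚-const 𝕫 f) (sym (const≈0 f))
  𝕫-⊚ f (suc n) = begin
    (𝕫 ⊚ f) (suc n)                       ≈⟨ ⊚-suc 𝕫 f n ⟩
    ((tail 𝕫 ⊚ f) ⊛ tail (series₁ f)) n   ≈⟨ ⊛-congˡ-≤ {n} (tail (series₁ f)) (λ m _ → trans (⊚-congʳ f tail-𝕫 m) (𝟙-⊚ f m)) ⟩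
    (𝟙 ⊛ tail (series₁ f)) n              ≈⟨ ⊛-identityˡ (tail (series₁ f)) n ⟩
    series₁ f (suc n)                     ∎
    where
    tail-𝕫 : tail 𝕫 ≋ 𝟙
    tail-𝕫 zero    = refl
    tail-𝕫 (suc _) = refl

  -- The tail of a product is a₀ · tail b + tail a · b by definition. Horner's rule therefore
  -- reduces the claim in degree n + 1 to the claim for `tail a` and `b` in degrees up to n.
  ⊚-⊛ : ∀ a b f → (a ⊛ b) ⊚ f ≋ (a ⊚ f) ⊛ (b ⊚ f)
  ⊚-⊛ a b f n = upTo n n ℕ.≤-refl a b
    where
    φ : Series
    φ = tail (series₁ f)
    -- `N` is fuel for a strong induction: every degree m ≤ n is called, so the recursion descends
    -- on `N` instead of the degree.
    upTo : ∀ N n → n ≤ N → ∀ a b → ((a ⊛ b) ⊚ f) n ≈ ((a ⊚ f) ⊛ (b ⊚ f)) n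
    upTo N zero _ a b = begin
      ((a ⊛ b) ⊚ f) 0            ≈⟨ ⊚-const (a ⊛ b) f ⟩
      (a ⊛ b) 0                  ≈⟨ ⊛-zero a b ⟩
      a 0 * b 0                  ≈⟨ *-cong (⊚-const a f) (⊚-const b f) ⟨
      (a ⊚ f) 0 * (b ⊚ f) 0      ≈⟨ ⊛-zero (a ⊚ f) (b ⊚ f) ⟨
      ((a ⊚ f) ⊛ (b ⊚ f)) 0      ∎
    upTo (suc N) (suc n) (s≤s n≤N) a b = begin
      ((a ⊛ b) ⊚ f) (suc n)
        ≈⟨ ⊚-suc (a ⊛ b) f n ⟩
      ((((a 0 ∙ tail b) ⊕ (tail a ⊛ b)) ⊚ f) ⊛ φ) n
        ≈⟨ ⊛-congˡ-≤ {n} φ (λ m m≤n → trans (⊚-⊕ (a 0 ∙ tail b) (tail a ⊛ b) f m)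
             (+-cong (⊚-∙ (a 0) (tail b) f m) (upTo N m (ℕ.≤-trans m≤n n≤N) (tail a) b))) ⟩
      (((a 0 ∙ (tail b ⊚ f)) ⊕ ((tail a ⊚ f) ⊛ (b ⊚ f))) ⊛ φ) n
        ≈⟨ ⊛-distribʳ φ (a 0 ∙ (tail b ⊚ f)) ((tail a ⊚ f) ⊛ (b ⊚ f)) n ⟩
      ((a 0 ∙ (tail b ⊚ f)) ⊛ φ) n + (((tail a ⊚ f) ⊛ (b ⊚ f)) ⊛ φ) n
        ≈⟨ +-cong (⊛-scale (a 0) (tail b ⊚ f) φ n) (xy∙z≈xz∙y (tail a ⊚ f) (b ⊚ f) φ n) ⟩
      a 0 * ((tail b ⊚ f) ⊛ φ) n + (((tail a ⊚ f) ⊛ φ) ⊛ (b ⊚ f)) n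
        ≈⟨ +-cong (*-cong (⊚-const a f) (⊚-suc b f n)) (⊛-congˡ-≤ {n} (b ⊚ f) (λ m _ → ⊚-suc a f m)) ⟨
      (a ⊚ f) 0 * (b ⊚ f) (suc n) + (tail (a ⊚ f) ⊛ (b ⊚ f)) n ∎
      where open CommutativeSemigroupProperties 𝓢.*-commutativeSemigroup using (xy∙z≈xz∙y)

  -- The linear coefficient of an involution.

  #⇒*-cancelʳ : ∀ {a b} x y → a # b → x * (a - b) ≈ y * (a - b) → x ≈ y
  #⇒*-cancelʳ {a} {b} x y a#b p with #⇒invertible a#b
  ... | i , _ , [a-b]i≈1 = begin
    x                  ≈⟨ expand x ⟩
    x * (a - b) * i    ≈⟨ *-congʳ p ⟩
    y * (a - b) * i    ≈⟨ expand y ⟨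
    y                  ∎
    where
    expand : ∀ x → x ≈ x * (a - b) * i
    expand x = sym (trans (*-assoc x (a - b) i) (trans (*-congˡ [a-b]i≈1) (*-identityʳ x)))

  Involution : F₁ → Set ℓ₁
  Involution w = series₁ w ⊚ w ≋ 𝕫

  -- The difference d = w - z satisfies d(w) = -d, so if w = z + ⋯ its lowest
  -- coefficient equals its own negative.
  involution-linear≈1⇒≋𝕫 : 1# # - 1# → ∀ w → Involution w → series₁ w 1 ≈ 1# → w ≋₁ 𝕫₁
  involution-linear≈1⇒≋𝕫 1#-1 w ww≋z w₁≈1 n = x∙y⁻¹≈ε⇒x≈y _ _ (<-rec (λ n → d n ≈ 0#) step n)
    where
    d : Series
    d = series₁ w ⊕ ⊖ 𝕫
    d⊚w : d ⊚ w ≋ ⊖ d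
    d⊚w n = begin
      (d ⊚ w) n                              ≈⟨ ⊚-⊕ (series₁ w) (⊖ 𝕫) w n ⟩
      (series₁ w ⊚ w) n + ((⊖ 𝕫) ⊚ w) n      ≈⟨ +-cong (ww≋z n) (trans (⊚-⊖ 𝕫 w n) (-‿cong (𝕫-⊚ w n))) ⟩
      𝕫 n - series₁ w n                      ≈⟨ ⁻¹-anti-homo‿- (series₁ w n) (𝕫 n) ⟨
      - d n                                  ∎
    step : ∀ n → (∀ {k} → k < n → d k ≈ 0#) → d n ≈ 0#
    step n below = #⇒*-cancelʳ (d n) 0# 1#-1 (begin
      d n * (1# - - 1#)              ≈⟨ *-congˡ (+-congˡ (-‿involutive 1#)) ⟩
      d n * (1# + 1#)                ≈⟨ distribˡ (d n) 1# 1# ⟩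
      d n * 1# + d n * 1#            ≈⟨ +-cong (*-congˡ (sym (^-coeff-1 w w₁≈1 n))) (*-identityʳ (d n)) ⟩
      d n * (series₁ w ^ n) n + d n  ≈⟨ +-congʳ (∑≤-last n (⊚-summand d w n) (λ k k<n → trans (*-congʳ (below k<n)) (zeroˡ _))) ⟨
      (d ⊚ w) n + d n                ≈⟨ +-congʳ (d⊚w n) ⟩
      - d n + d n                    ≈⟨ -‿inverseˡ (d n) ⟩
      0#                             ≈⟨ zeroˡ _ ⟨
      0# * (1# - - 1#)               ∎)

  -- Cotransitivity places w₁ apart from 1 or from -1. In the second case w₁² = 1 gives w₁(w₁ + 1) =
  -- w₁ + 1 with w₁ + 1 invertible, so w₁ = 1, which would force w = z. The result is an apartness,
  -- as needed to cancel 1 - w₁ later.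
  involution⇒1#linear : 1# # - 1# → ∀ w → Involution w → ¬ (w ≋₁ 𝕫₁) → 1# # series₁ w 1
  involution⇒1#linear 1#-1 w ww≋z w≉z with #-cotrans 1#-1 (series₁ w 1)
  ... | inj₁ 1#w₁  = 1#w₁
  ... | inj₂ w₁#-1 = contradiction (involution-linear≈1⇒≋𝕫 1#-1 w ww≋z w₁≈1) w≉z
    where
    w₁ : Carrier
    w₁ = series₁ w 1
    w₁≈1 : w₁ ≈ 1#
    w₁≈1 = #⇒*-cancelʳ w₁ 1# w₁#-1 (begin
      w₁ * (w₁ - - 1#)    ≈⟨ *-congˡ (+-congˡ (-‿involutive 1#)) ⟩
      w₁ * (w₁ + 1#)      ≈⟨ distribˡ w₁ w₁ 1# ⟩
      w₁ * w₁ + w₁ * 1#   ≈⟨ +-cong (trans (sym (⊚-linear w w)) (ww≋z 1)) (*-identityʳ w₁) ⟩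
      1# + w₁             ≈⟨ +-comm 1# w₁ ⟩
      w₁ + 1#             ≈⟨ +-congˡ (-‿involutive 1#) ⟨
      w₁ - - 1#           ≈⟨ *-identityˡ _ ⟨
      1# * (w₁ - - 1#)    ∎)

  -- The group of series with g · g(w) = 1.

  Reciprocal : F₁ → F₀ → Set ℓ₁
  Reciprocal w g = series g ⊛ (series g ⊚ w) ≋ 𝟙

  interchange-𝟙 : ∀ {a b c d} → a ⊛ c ≋ 𝟙 → b ⊛ d ≋ 𝟙 → (a ⊛ b) ⊛ (c ⊛ d) ≋ 𝟙
  interchange-𝟙 {a} {b} {c} {d} ac≋1 bd≋1 = ≋-Reasoning.begin
    (a ⊛ b) ⊛ (c ⊛ d)  ≋-Reasoning.≈⟨ ⊛-interchange a b c d ⟩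
    (a ⊛ c) ⊛ (b ⊛ d)  ≋-Reasoning.≈⟨ ⊛-cong ac≋1 bd≋1 ⟩
    𝟙 ⊛ 𝟙              ≋-Reasoning.≈⟨ ⊛-identityˡ 𝟙 ⟩
    𝟙                  ≋-Reasoning.∎

  ⊚-⁻¹₀-inverseˡ : ∀ g w → (series (g ⁻¹₀) ⊚ w) ⊛ (series g ⊚ w) ≋ 𝟙
  ⊚-⁻¹₀-inverseˡ g w = ≋-Reasoning.begin
    (series (g ⁻¹₀) ⊚ w) ⊛ (series g ⊚ w)  ≋-Reasoning.≈⟨ ⊚-⊛ (series (g ⁻¹₀)) (series g) w ⟨
    (series (g ⁻¹₀) ⊛ series g) ⊚ w        ≋-Reasoning.≈⟨ ⊚-congʳ w (⁻¹₀-inverseˡ g) ⟩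
    𝟙 ⊚ w                                  ≋-Reasoning.≈⟨ 𝟙-⊚ w ⟩
    𝟙                                      ≋-Reasoning.∎

  reciprocal-resp : ∀ {w v g h} → w ≋₁ v → g ≋₀ h → Reciprocal w g → Reciprocal v h
  reciprocal-resp {w} {v} {g} {h} w≋v g≋h gg≋1 = 𝓢.trans
    (𝓢.sym (⊛-cong g≋h (⊚-cong {f = w} {v} g≋h w≋v))) gg≋1

  reciprocal-isSubgroup : ∀ w → IsSubgroup F₀-group (Reciprocal w)
  reciprocal-isSubgroup w = record
    { respects-≈ = λ {g} {h} → reciprocal-resp {w} {w} {g} {h} 𝓢.refl
    ; ε-closed   = 𝓢.trans (⊛-identityˡ (𝟙 ⊚ w)) (𝟙-⊚ w)
    ; ∙-closed   = λ {g} {h} gg≋1 hh≋1 → 𝓢.trans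
        (𝓢.*-congˡ {series g ⊛ series h} (⊚-⊛ (series g) (series h) w))
        (interchange-𝟙 {series g} {series h} gg≋1 hh≋1)
    -- Multiplying i · i(w) by g · g(w) = 1 changes nothing; regrouping pairs i with g and i(w) with
    -- g(w), and both products are 1.
    ; ⁻¹-closed  = λ {g} gg≋1 → let i = series (g ⁻¹₀) in 𝓢.trans
        (𝓢.sym (𝓢.trans (𝓢.*-congˡ {i ⊛ (i ⊚ w)} gg≋1) (⊛-identityʳ (i ⊛ (i ⊚ w)))))
        (interchange-𝟙 {i} {i ⊚ w} (⁻¹₀-inverseˡ g) (⊚-⁻¹₀-inverseˡ g w))
    }

  -- Substitution of w swaps h and k, hence turns h/k into its inverse k/h. In the regrouped
  -- product, k⁻¹(w) cancels h = k(w), and k⁻¹ cancels h(w) = k.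
  reciprocal-quotient : ∀ w h k → series h ⊚ w ≋ series k → series k ⊚ w ≋ series h →
                        Reciprocal w (h ⊛₀ k ⁻¹₀)
  reciprocal-quotient w h k hw≋k kw≋h = ≋-Reasoning.begin
    (series h ⊛ i) ⊛ ((series h ⊛ i) ⊚ w)          ≋-Reasoning.≈⟨ 𝓢.*-congˡ {series h ⊛ i} (⊚-⊛ (series h) i w) ⟩
    (series h ⊛ i) ⊛ ((series h ⊚ w) ⊛ (i ⊚ w))    ≋-Reasoning.≈⟨ 𝓢.*-congˡ {series h ⊛ i} (⊛-comm (series h ⊚ w) (i ⊚ w)) ⟩
    (series h ⊛ i) ⊛ ((i ⊚ w) ⊛ (series h ⊚ w))    ≋-Reasoning.≈⟨ interchange-𝟙 {series h} {i} h⊛iw≋1 i⊛hw≋1 ⟩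
    𝟙                                              ≋-Reasoning.∎
    where
    i : Series
    i = series (k ⁻¹₀)
    h⊛iw≋1 : series h ⊛ (i ⊚ w) ≋ 𝟙
    h⊛iw≋1 = 𝓢.trans (𝓢.*-congʳ {i ⊚ w} (𝓢.sym kw≋h))
      (𝓢.trans (⊛-comm (series k ⊚ w) (i ⊚ w)) (⊚-⁻¹₀-inverseˡ k w))
    i⊛hw≋1 : i ⊛ (series h ⊚ w) ≋ 𝟙
    i⊛hw≋1 = 𝓢.trans (𝓢.*-congˡ {i} hw≋k) (⁻¹₀-inverseˡ k)

  -- The quotients (1 + x z) / (1 + x w).

  1+∙-const : ∀ x l → 1# + x * series₁ l 0 ≈ 1#
  1+∙-const x l = trans (+-congˡ (trans (*-congˡ (const≈0 l)) (zeroʳ x))) (+-identityʳ 1#)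

  1+_∙_ : Carrier → F₁ → F₀
  1+ x ∙ l = record
    { series  = 𝟙 ⊕ x ∙ series₁ l
    ; const#0 = #-congʳ (sym (1+∙-const x l)) 1#0
    }

  1+∙-⊚ : ∀ x l w → series (1+ x ∙ l) ⊚ w ≋ series (1+ x ∙ (l ⊚₁ w))
  1+∙-⊚ x l w n = trans (⊚-⊕ 𝟙 (x ∙ series₁ l) w n) (+-cong (𝟙-⊚ w n) (⊚-∙ x (series₁ l) w n))

  1+∙-cong : ∀ x {l m} → l ≋₁ m → 1+ x ∙ l ≋₀ 1+ x ∙ m
  1+∙-cong x l≋m n = +-congˡ (*-congˡ (l≋m n))

  ratio : F₁ → Carrier → F₀
  ratio w x = (1+ x ∙ 𝕫₁) ⊛₀ (1+ x ∙ w) ⁻¹₀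

  -- Numerator and denominator are exchanged by w, since z(w) = w and w(w) = z.
  ratio-reciprocal : ∀ w → Involution w → ∀ x → Reciprocal w (ratio w x)
  ratio-reciprocal w ww≋z x = reciprocal-quotient w (1+ x ∙ 𝕫₁) (1+ x ∙ w)
    (𝓢.trans (1+∙-⊚ x 𝕫₁ w) (1+∙-cong x {𝕫₁ ⊚₁ w} {w} (𝕫-⊚ w)))
    (𝓢.trans (1+∙-⊚ x w w) (1+∙-cong x {w ⊚₁ w} {𝕫₁} ww≋z))

  -- The quotient g need not be expanded: with h = 1 + x z and k = 1 + x w, the equation g · k = h
  -- gives g₀ = 1 in degree zero and then g₁ + x w₁ = x in degree one.
  ratio-linear : ∀ w x → series (ratio w x) 1 ≈ x * (1# - series₁ w 1)
  ratio-linear w x = begin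
    g 1                                   ≈⟨ //-rightDividesʳ (x * w₁) (g 1) ⟨
    g 1 + x * w₁ - x * w₁                 ≈⟨ +-congʳ g₁+xw₁≈x ⟩
    x - x * w₁                            ≈⟨ +-cong (sym (*-identityʳ x)) (-‿distribʳ-* x w₁) ⟩
    x * 1# + x * - w₁                     ≈⟨ distribˡ x 1# (- w₁) ⟨
    x * (1# - w₁)                         ∎
    where
    w₁ : Carrier
    w₁ = series₁ w 1
    g h k : Series
    g = series (ratio w x)
    h = series (1+ x ∙ 𝕫₁)
    k = series (1+ x ∙ w)
    gk≋h : g ⊛ k ≋ h
    gk≋h = 𝓢.trans (⊛-assoc h (series ((1+ x ∙ w) ⁻¹₀)) k)
      (𝓢.trans (𝓢.*-congˡ {h} (⁻¹₀-inverseˡ (1+ x ∙ w))) (⊛-identityʳ h))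
    g₀≈1 : g 0 ≈ 1#
    g₀≈1 = begin
      g 0         ≈⟨ *-identityʳ (g 0) ⟨
      g 0 * 1#    ≈⟨ *-congˡ (1+∙-const x w) ⟨
      g 0 * k 0   ≈⟨ ⊛-zero g k ⟨
      (g ⊛ k) 0   ≈⟨ gk≋h 0 ⟩
      h 0         ≈⟨ 1+∙-const x 𝕫₁ ⟩
      1#          ∎
    g₁+xw₁≈x : g 1 + x * w₁ ≈ x
    g₁+xw₁≈x = begin
      g 1 + x * w₁                     ≈⟨ +-comm (g 1) (x * w₁) ⟩
      x * w₁ + g 1                     ≈⟨ +-cong (+-identityˡ (x * w₁)) (*-identityʳ (g 1)) ⟨
      k 1 + g 1 * 1#                   ≈⟨ +-cong (*-identityˡ (k 1)) (*-congˡ (1+∙-const x w)) ⟨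
      1# * k 1 + g 1 * k 0             ≈⟨ +-cong (*-congʳ g₀≈1) (⊛-zero (tail g) k) ⟨
      (g ⊛ k) 1                        ≈⟨ gk≋h 1 ⟩
      0# + x * 1#                      ≈⟨ trans (+-identityˡ (x * 1#)) (*-identityʳ x) ⟩
      x                                ∎

  -- The coefficient of z alone separates the parameters, because 1 - w₁ can be cancelled.
  ratio-injective : ∀ w → 1# # series₁ w 1 → ∀ x y → ratio w x ≋₀ ratio w y → x ≈ y
  ratio-injective w 1#w₁ x y gx≋gy = #⇒*-cancelʳ x y 1#w₁
    (trans (sym (ratio-linear w x)) (trans (gx≋gy 1) (ratio-linear w y)))

  -- Characteristic zero.

  open RawMonoidDefinitions +-rawMonoid public using () renaming (_×_ to _×ᴷ_)

  -- Apartness is chosen over mere inequality so that each positive integer is invertible, in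
  -- particular 2.
  CharacteristicZero : Set ℓ₂
  CharacteristicZero = ∀ n → suc n ×ᴷ 1# # 0#

  ×ᴷ1-injective : CharacteristicZero → ∀ m n → m ×ᴷ 1# ≈ n ×ᴷ 1# → m ≡ n
  ×ᴷ1-injective char0 zero    zero    _ = ≡.refl
  ×ᴷ1-injective char0 zero    (suc n) p = contradiction (char0 n) (#-irrefl (sym p))
  ×ᴷ1-injective char0 (suc m) zero    p = contradiction (char0 m) (#-irrefl p)
  ×ᴷ1-injective char0 (suc m) (suc n) p =
    ≡.cong suc (×ᴷ1-injective char0 m n (+-cancelˡ 1# _ _ p))

  characteristicZero⇒1#-1 : CharacteristicZero → 1# # - 1#
  -- Index 1 stands for 2 = 1 + (1 + 0), whose inverse also inverts 1 - (-1).
  characteristicZero⇒1#-1 char0 with #⇒invertible (char0 1)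
  ... | i , i*2≈1 , _ = invertibleˡ⇒# (i , (begin
    i * (1# - - 1#)               ≈⟨ *-congˡ (+-congˡ (-‿involutive 1#)) ⟩
    i * (1# + 1#)                 ≈⟨ *-congˡ (+-congˡ (+-identityʳ 1#)) ⟨
    i * (1# + (1# + 0#))          ≈⟨ *-congˡ (x-0≈x _) ⟨
    i * (1# + (1# + 0#) - 0#)     ≈⟨ i*2≈1 ⟩
    1#                            ∎))

  -- Pseudo-involutions as solutions of g · g(w) = 1.

  module _ (f : F₁) where

    -- Written as the second component of `L *ᴿ M`, so that `IsPseudoInvolution` unfolds to it;
    -- `-f≋⊖f` identifies it with the coefficientwise negative.
    -f : F₁
    -f = (⊖₁ 𝕫₁) ⊚₁ f

    -f≋⊖f : -f ≋₁ ⊖₁ f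
    -f≋⊖f n = trans (⊚-⊖ 𝕫 f n) (-‿cong (𝕫-⊚ f n))

    g*M≋g : ∀ g → g ⊛₀ (𝟙₀ ⊚₀ f) ≋₀ g
    g*M≋g g = 𝓢.trans (𝓢.*-congˡ {series g} (𝟙-⊚ f)) (⊛-identityʳ (series g))

  -- Unfolding the square of `L *ᴿ M` gives `Reciprocal` for `-f f` and `g ⊛₀ (𝟙₀ ⊚₀ f)` in the
  -- first component and `-f f` composed with itself in the second. It remains to replace these
  -- representatives by equal ones.
  reciprocal⇒pseudoInvolution : ∀ L → let open Riordan L in
    Involution (⊖₁ f) → Reciprocal (⊖₁ f) g → IsPseudoInvolution L
  reciprocal⇒pseudoInvolution ⟪ g , f ⟫ involution gg≋1 =
    reciprocal-resp {⊖₁ f} { -f f } {g} {g ⊛₀ (𝟙₀ ⊚₀ f)} (𝓢.sym (-f≋⊖f f)) (𝓢.sym (g*M≋g f g)) gg≋1 ,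
    𝓢.trans (⊚-cong {f = -f f} {⊖₁ f} (-f≋⊖f f) (-f≋⊖f f)) involution

  pseudoInvolution⇒reciprocal : ∀ L → let open Riordan L in
    IsPseudoInvolution L → Reciprocal (⊖₁ f) g
  pseudoInvolution⇒reciprocal ⟪ g , f ⟫ (gg≋1 , _) =
    reciprocal-resp { -f f } {⊖₁ f} {g ⊛₀ (𝟙₀ ⊚₀ f)} {g} (-f≋⊖f f) (g*M≋g f g) gg≋1

-- The complex numbers have characteristic zero.

module ComplexCharacteristic where

  open Defs.Rationals using (0<1)
  open Defs.Reals using (seq; mkNonZero)
  open Defs.Complex using (re; re-#; 1ᶜ; ℂ-field)
  open Substitution ℂ-field using (CharacteristicZero; _×ᴷ_)
  open import Data.Rational using (0ℚ; 1ℚ; _+_; _-_; ∣_∣) renaming (_≤_ to _≤ℚ_)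
  open import Data.Rational.Properties

  -- Stated for each term of the representing rational sequence, so that no order on the reals is
  -- needed.
  0≤re-× : ∀ n k → 0ℚ ≤ℚ seq (re (n ×ᴷ 1ᶜ)) k
  0≤re-× zero    k = ≤-refl
  0≤re-× (suc n) k = +-mono-≤ (<⇒≤ 0<1) (0≤re-× n k)

  characteristicZero : CharacteristicZero
  -- Every term of the real part of n + 1 is at least 1, so the bound 1 works from index 0 on.
  characteristicZero n = re-# (mkNonZero 1ℚ 0<1 (0 , λ k _ → away (0≤re-× n k)))
    where
    away : ∀ {x} → 0ℚ ≤ℚ x → 1ℚ ≤ℚ ∣ 1ℚ + x - 0ℚ ∣
    away {x} 0≤x = begin
      1ℚ                 ≡⟨ +-identityʳ 1ℚ ⟨
      1ℚ + 0ℚ            ≤⟨ +-monoʳ-≤ 1ℚ 0≤x ⟩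
      1ℚ + x             ≡⟨ +-identityʳ (1ℚ + x) ⟨
      1ℚ + x - 0ℚ        ≡⟨ 0≤p⇒∣p∣≡p (+-mono-≤ (+-mono-≤ (<⇒≤ 0<1) 0≤x) ≤-refl) ⟨
      ∣ 1ℚ + x - 0ℚ ∣    ∎
      where open ≤-Reasoning

open import Defs

theorem25 : (f : F₁) → (⊖₁ f) ⊚₁ (⊖₁ f) ≋₁ 𝕫₁ → ¬ (⊖₁ f ≋₁ 𝕫₁) →
    IsSubgroup F₀-group (λ g → IsPseudoInvolution ⟪ g , f ⟫) ×
    Infinite (subsetSetoid (Group.setoid F₀-group) (λ g → IsPseudoInvolution ⟪ g , f ⟫))
theorem25 f involution -f≉z =
  isSubgroup-resp-⇔ F₀-group to from (reciprocal-isSubgroup (⊖₁ f)) ,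
  record
    -- The parameters are the multiples n · 1 in ℂ, pairwise distinct by characteristic zero; n = 0
    -- gives the identity.
    { to        = λ n → element n , to (element n) (ratio-reciprocal (⊖₁ f) involution (n ×ᴷ 1ᶜ))
    ; cong      = λ { ≡.refl → ≋-refl }
    ; injective = λ {m} {n} p →
        ×ᴷ1-injective characteristicZero m n (ratio-injective (⊖₁ f) 1#-f₁ (m ×ᴷ 1ᶜ) (n ×ᴷ 1ᶜ) p)
    }
  where
  open Complex using (_#_; 1ᶜ; ℂ-field)
  open ComplexCharacteristic using (characteristicZero)
  open Substitution ℂ-field
  element : ℕ → F₀
  element n = ratio (⊖₁ f) (n ×ᴷ 1ᶜ)
  ≋-refl : ∀ {a : Series} → a ≋ a
  ≋-refl {a} n = HeytingField.refl ℂ-field {a n}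
  to : ∀ g → Reciprocal (⊖₁ f) g → IsPseudoInvolution ⟪ g , f ⟫
  to g = toPI ⟪ g , f ⟫ involution
    where
    toPI : ∀ L → Involution (⊖₁ Riordan.f L) → Reciprocal (⊖₁ Riordan.f L) (Riordan.g L) → IsPseudoInvolution L
    toPI = reciprocal⇒pseudoInvolution
  from : ∀ g → IsPseudoInvolution ⟪ g , f ⟫ → Reciprocal (⊖₁ f) g
  from g = fromPI ⟪ g , f ⟫
    where
    fromPI : ∀ L → IsPseudoInvolution L → Reciprocal (⊖₁ Riordan.f L) (Riordan.g L)
    fromPI = pseudoInvolution⇒reciprocal
  1#-f₁ : 1ᶜ # series₁ (⊖₁ f) 1
  1#-f₁ = involution⇒1#linear (characteristicZero⇒1#-1 characteristicZero) (⊖₁ f) involution -f≉z
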